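{- If $\mathcal{O}$ is a decomposable set of Scott-open modalities, then the open extension of the relation of applicative $\mathcal{O}$-similarity is compatible.
   Context: Language: types $\tau ::= \mathbf{1} \mid \mathbf{N} \mid \tau \to \tau'$; signature $\Sigma$ of effect operations with arities $\alpha^n\to\alpha$, $\mathbf{N}\times\alpha^n\to\alpha$, $\alpha^{\mathbf{N}}\to\alpha$ or $\mathbf{N}\times\alpha^{\mathbf{N}}\to\alpha$. Values $V ::= * \mid Z \mid S(V) \mid \lambda x{:}\tau.M \mid x$; computations $M ::= VW \mid \mathbf{return}\,V \mid \mathbf{let}\ M\Rightarrow x\ \mathbf{in}\ N \mid \mathbf{fix}(V) \mid \mathbf{case}\ V\ \mathbf{of}\ \{Z\Rightarrow M; S(x)\Rightarrow N\} \mid \sigma(M_0,\dots) \mid \sigma(V;M_0,\dots) \mid \sigma(V)\mid\sigma(V;W)$, simply typed call-by-value. $\mathit{Val}(\tau)$, $\mathit{Com}(\tau)$: closed values/computations. Effect trees $TX$: possibly infinite trees with leaves $\bot$ or elements of $X$ and internal nodes labelled by effect operations (or $\sigma_m$, $m\in\mathbb{N}$) with $n$ or $\mathbb{N}$-many children according to arity; $t\le t'$ iff $t$ results from $t'$ by replacing subtrees with $\bot$ ($\omega$-cpo). $\mu:TTX\to TX$ flattens trees of trees. Each $M\in\mathit{Com}(\tau)$ has an operational effect tree $|M|\in T(\mathit{Val}(\tau))$ from call-by-value evaluation. Modalities: set $\mathcal{O}$, $[\![o]\!]\subseteq T\mathbf{1}$; $t[\in P]$ replaces leaves in $P$ by $*$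 and others by $\bot$; $o(A)=\{t\mid t[\in A]\in[\![o]\!]\}$. Scott-open: $[\![o]\!]$ upward closed, and if the supremum of an ascending chain lies in $[\![o]\!]$ then some chain element does. Decomposability: $\mathcal{T}$ is the least class containing $o(\top),o(\bot)$ ($o\in\mathcal{O}$) closed under arbitrary $\bigvee,\bigwedge$, with $[\![o(\top)]\!]=o(\{*\})$, $[\![o(\bot)]\!]=o(\emptyset)$. $t\trianglelefteq t'$ on $T\mathbf{1}$ iff $\forall\Phi\in\mathcal{T}$, $t\in[\![\Phi]\!]\Rightarrow t'\in[\![\Phi]\!]$; $r\preccurlyeq r'$ on $TT\mathbf{1}$ iff $\forall o\,\forall\Phi\in\mathcal{T}$, $r\in o([\![\Phi]\!])\Rightarrow r'\in o([\![\Phi]\!])$. $\mathcal{O}$ is decomposable if $r\preccurlyeq r'$ implies $\mu r\trianglelefteq\mu r'$. Similarity: $t\,\mathcal{O}(R)\,t'$ iff $\forall A\,\forall o$, $t\in o(A)\Rightarrow t'\in o(R[A])$ where $R[A]=\{y\mid\exists x\in A, xRy\}$. An applicative $\mathcal{O}$-simulation is a family $R^v_\tau\subseteq\mathit{Val}(\tau)^2$, $R^c_\tau\subseteq\mathit{Com}(\tau)^2$ with (1) $V R^v_{\mathbf{N}}W\Rightarrow V=W$; (2) $MR^c_\tau N\Rightarrow|M|\,\mathcal{O}(R^v_\tau)\,|N|$; (3) $VR^v_{\tau'\to\tau}W\Rightarrow\forall U\in\mathit{Val}(\tau')$, $VU\,R^c_\tau\,WU$; applicative $\mathcal{O}$-similarity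 is the union of all of them. Open extension / compatibility: $\Gamma\vdash M\,R^\circ\,N$ iff $M[\vec V/\vec x]\,R\,N[\vec V/\vec x]$ for all closed value instantiations of $\Gamma$; an open relation is compatible if it relates each variable to itself and is closed under every term constructor (terms built by the same constructor from related immediate subterms are related). -}

module Defs where

open import Axiom.ExcludedMiddle using (ExcludedMiddle)
open import Data.Fin.Base using (Fin; fromℕ<)
open import Data.List.Base using (List; []; _∷_; _∷ʳ_)
open import Data.List.Membership.Propositional using (_∈_)
open import Data.List.Relation.Unary.Any using (here; there)
open import Data.Nat.Base using (ℕ; zero; suc; _<_)
open import Data.Nat.Properties using (_<?_)
open import Data.Product.Base using (Σ-syntax; ∃; ∃-syntax; _×_; _,_)
open import Data.Sum.Base using (_⊎_)
open import Data.Unit.Base using (⊤; tt)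
open import Data.Vec.Base using (Vec; []; _∷_; lookup)
open import Data.Vec.Relation.Binary.Pointwise.Inductive using (Pointwise)
open import Level using (Level; 0ℓ) renaming (suc to lsuc)
open import Relation.Binary.Core using (REL)
open import Relation.Binary.PropositionalEquality using (_≡_; _≢_; refl; subst; sym; trans)
open import Relation.Nullary using (Dec; yes; no; contradiction)
open import Relation.Unary using (Pred; U; ∅; ⋃; ⋂)

-- The four operation shapes: αⁿ → α, N × αⁿ → α, α^N → α, N × α^N → α.

data Arity : Set where
  fin     : ℕ → Arity
  nat×fin : ℕ → Arity
  inf     : Arity
  nat×inf : Arity

Signature : Set₁
Signature = Arity → Set

Param : Arity → Set
Param (fin _)     = ⊤
Param (nat×fin _) = ℕ
Param inf         = ⊤
Param nat×inf     = ℕ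

-- HasChild a i: nodes of arity a have a child with index i (counted from 0).

HasChild : Arity → ℕ → Set
HasChild (fin n)     i = i < n
HasChild (nat×fin n) i = i < n
HasChild inf         i = ⊤
HasChild nat×inf     i = ⊤

hasChild? : ∀ a i → Dec (HasChild a i)
hasChild? (fin n)     i = i <? n
hasChild? (nat×fin n) i = i <? n
hasChild? inf         i = yes tt
hasChild? nat×inf     i = yes tt

record Label (Sig : Signature) : Set where
  constructor label
  field
    {arity}   : Arity
    operation : Sig arity
    parameter : Param arity

------------------------------------------------------------------------
-- Effect trees

data Cell (Sig : Signature) (X : Set) : Set where
  bot  : Cell Sig X
  leaf : X → Cell Sig X
  node : Label Sig → Cell Sig X

-- A possibly infinite tree is a labelling of the positions in ℕ*, with bot
-- both at the ⊥-leaves and at the positions that lie outside the tree.  Two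
-- trees are equal when each is ⊑ the other; ≡ on Tree is finer than that.

record Tree (Sig : Signature) (X : Set) : Set where
  field
    at : List ℕ → Cell Sig X
    wf : ∀ p i → at (p ∷ʳ i) ≢ bot →
         ∃[ l ] at p ≡ node l × HasChild (Label.arity l) i

open Tree public

module _ {Sig : Signature} where

  infix 4 _⊑_

  _⊑_ : ∀ {X} → Tree Sig X → Tree Sig X → Set
  t ⊑ t′ = ∀ p → at t p ≡ bot ⊎ at t p ≡ at t′ p

  Ascending : ∀ {X} → (ℕ → Tree Sig X) → Set
  Ascending s = ∀ n → s n ⊑ s (suc n)

  IsSupremum : ∀ {X} → (ℕ → Tree Sig X) → Tree Sig X → Set
  IsSupremum s t = (∀ n → s n ⊑ t) × (∀ u → (∀ n → s n ⊑ u) → t ⊑ u)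

  flatten : ∀ {X} → (List ℕ → Cell Sig (Tree Sig X)) → List ℕ → Cell Sig X
  flatten r p with r []
  flatten r p       | bot    = bot
  flatten r p       | leaf u = at u p
  flatten r []      | node l = node l
  flatten r (i ∷ p) | node l = flatten (λ q → r (i ∷ q)) p

  flatten-root : ∀ {X} (r : List ℕ → Cell Sig (Tree Sig X)) →
                 flatten r [] ≢ bot → r [] ≢ bot
  flatten-root r ≢bot eq with r []
  flatten-root r ≢bot refl | bot = ≢bot refl

  flatten-wf : ∀ {X} (r : List ℕ → Cell Sig (Tree Sig X)) →
    (∀ p i → r (p ∷ʳ i) ≢ bot →
       ∃[ l ] r p ≡ node l × HasChild (Label.arity l) i) →
    ∀ p i → flatten r (p ∷ʳ i) ≢ bot →
       ∃[ l ] flatten r p ≡ node l × HasChild (Label.arity l) i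
  flatten-wf r r-wf p i ≢bot with r [] in eq
  flatten-wf r r-wf p       i ≢bot | bot    = contradiction refl ≢bot
  flatten-wf r r-wf p       i ≢bot | leaf u = wf u p i ≢bot
  flatten-wf r r-wf []      i ≢bot | node l
    with r-wf [] i (flatten-root (λ q → r (i ∷ q)) ≢bot)
  ... | l′ , eq′ , h with trans (sym eq) eq′
  ... | refl = l , refl , h
  flatten-wf r r-wf (j ∷ p) i ≢bot | node l =
    flatten-wf (λ q → r (j ∷ q)) (λ q → r-wf (j ∷ q)) p i ≢bot

  μ : ∀ {X} → Tree Sig (Tree Sig X) → Tree Sig X
  μ r .at = flatten (at r)
  μ r .wf = flatten-wf (at r) (wf r)

module _ (em : ExcludedMiddle 0ℓ) {Sig : Signature} where

  restrictCell : ∀ {X} → Pred X 0ℓ → Cell Sig X → Cell Sig ⊤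
  restrictCell P bot      = bot
  restrictCell P (node l) = node l
  restrictCell P (leaf x) with em {P x}
  ... | yes _ = leaf tt
  ... | no  _ = bot

  -- t [∈ P ]

  restrict : ∀ {X} → Pred X 0ℓ → Tree Sig X → Tree Sig ⊤
  restrict P t .at p = restrictCell P (at t p)
  restrict P t .wf p i ≢bot
    with wf t p i (λ eq → ≢bot (subst (λ c → restrictCell P c ≡ bot) (sym eq) refl))
  ... | l , eq , h = l , subst (λ c → restrictCell P c ≡ node l) (sym eq) refl , h

------------------------------------------------------------------------
-- Syntax: intrinsically typed terms

infixr 7 _⇒_

data Ty : Set where
  𝟏 𝐍 : Ty
  _⇒_ : Ty → Ty → Ty

Ctx : Set
Ctx = List Ty

module _ (Sig : Signature) where

  infixl 9 _·_

  mutual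
    data Val (Γ : Ctx) : Ty → Set where
      ⋆   : Val Γ 𝟏
      Z   : Val Γ 𝐍
      S   : Val Γ 𝐍 → Val Γ 𝐍
      ƛ   : ∀ {τ ρ} → Com (τ ∷ Γ) ρ → Val Γ (τ ⇒ ρ)
      var : ∀ {τ} → τ ∈ Γ → Val Γ τ

    data Com (Γ : Ctx) : Ty → Set where
      _·_        : ∀ {τ ρ} → Val Γ (τ ⇒ ρ) → Val Γ τ → Com Γ ρ
      return     : ∀ {τ} → Val Γ τ → Com Γ τ
      let-in     : ∀ {τ ρ} → Com Γ τ → Com (τ ∷ Γ) ρ → Com Γ ρ
      fix        : ∀ {τ ρ} → Val Γ ((τ ⇒ ρ) ⇒ (τ ⇒ ρ)) → Com Γ (τ ⇒ ρ)
      case       : ∀ {τ} → Val Γ 𝐍 → Com Γ τ → Com (𝐍 ∷ Γ) τ → Com Γ τ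
      op-fin     : ∀ {τ n} → Sig (fin n) → Vec (Com Γ τ) n → Com Γ τ
      op-nat×fin : ∀ {τ n} → Sig (nat×fin n) → Val Γ 𝐍 → Vec (Com Γ τ) n → Com Γ τ
      op-inf     : ∀ {τ} → Sig inf → Val Γ (𝐍 ⇒ τ) → Com Γ τ
      op-nat×inf : ∀ {τ} → Sig nat×inf → Val Γ 𝐍 → Val Γ (𝐍 ⇒ τ) → Com Γ τ

module _ {Sig : Signature} where

  Ren : Ctx → Ctx → Set
  Ren Γ Δ = ∀ {τ} → τ ∈ Γ → τ ∈ Δ

  liftRen : ∀ {Γ Δ τ} → Ren Γ Δ → Ren (τ ∷ Γ) (τ ∷ Δ)
  liftRen r (here eq) = here eq
  liftRen r (there x) = there (r x)

  renVal  : ∀ {Γ Δ τ} → Ren Γ Δ → Val Sig Γ τ → Val Sig Δ τ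
  renCom  : ∀ {Γ Δ τ} → Ren Γ Δ → Com Sig Γ τ → Com Sig Δ τ
  renComs : ∀ {Γ Δ τ n} → Ren Γ Δ → Vec (Com Sig Γ τ) n → Vec (Com Sig Δ τ) n

  renVal r ⋆       = ⋆
  renVal r Z       = Z
  renVal r (S V)   = S (renVal r V)
  renVal r (ƛ M)   = ƛ (renCom (liftRen r) M)
  renVal r (var x) = var (r x)

  renCom r (V · W)             = renVal r V · renVal r W
  renCom r (return V)          = return (renVal r V)
  renCom r (let-in M N)        = let-in (renCom r M) (renCom (liftRen r) N)
  renCom r (fix V)             = fix (renVal r V)
  renCom r (case V M N)        = case (renVal r V) (renCom r M) (renCom (liftRen r) N)
  renCom r (op-fin σ Ms)       = op-fin σ (renComs r Ms)
  renCom r (op-nat×fin σ V Ms) = op-nat×fin σ (renVal r V) (renComs r Ms)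
  renCom r (op-inf σ V)        = op-inf σ (renVal r V)
  renCom r (op-nat×inf σ V W)  = op-nat×inf σ (renVal r V) (renVal r W)

  renComs r []       = []
  renComs r (M ∷ Ms) = renCom r M ∷ renComs r Ms

  weaken : ∀ {Γ τ ρ} → Val Sig Γ τ → Val Sig (ρ ∷ Γ) τ
  weaken = renVal there

  Sub : Ctx → Ctx → Set
  Sub Γ Δ = ∀ {τ} → τ ∈ Γ → Val Sig Δ τ

  liftSub : ∀ {Γ Δ τ} → Sub Γ Δ → Sub (τ ∷ Γ) (τ ∷ Δ)
  liftSub s (here eq) = var (here eq)
  liftSub s (there x) = weaken (s x)

  subVal  : ∀ {Γ Δ τ} → Sub Γ Δ → Val Sig Γ τ → Val Sig Δ τ
  subCom  : ∀ {Γ Δ τ} → Sub Γ Δ → Com Sig Γ τ → Com Sig Δ τ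
  subComs : ∀ {Γ Δ τ n} → Sub Γ Δ → Vec (Com Sig Γ τ) n → Vec (Com Sig Δ τ) n

  subVal s ⋆       = ⋆
  subVal s Z       = Z
  subVal s (S V)   = S (subVal s V)
  subVal s (ƛ M)   = ƛ (subCom (liftSub s) M)
  subVal s (var x) = s x

  subCom s (V · W)             = subVal s V · subVal s W
  subCom s (return V)          = return (subVal s V)
  subCom s (let-in M N)        = let-in (subCom s M) (subCom (liftSub s) N)
  subCom s (fix V)             = fix (subVal s V)
  subCom s (case V M N)        = case (subVal s V) (subCom s M) (subCom (liftSub s) N)
  subCom s (op-fin σ Ms)       = op-fin σ (subComs s Ms)
  subCom s (op-nat×fin σ V Ms) = op-nat×fin σ (subVal s V) (subComs s Ms)
  subCom s (op-inf σ V)        = op-inf σ (subVal s V)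
  subCom s (op-nat×inf σ V W)  = op-nat×inf σ (subVal s V) (subVal s W)

  subComs s []       = []
  subComs s (M ∷ Ms) = subCom s M ∷ subComs s Ms

  infixl 10 _[_]

  single : ∀ {Γ τ} → Val Sig Γ τ → Sub (τ ∷ Γ) Γ
  single V (here refl) = V
  single V (there x)   = var x

  _[_] : ∀ {Γ τ ρ} → Com Sig (τ ∷ Γ) ρ → Val Sig Γ τ → Com Sig Γ ρ
  M [ V ] = subCom (single V) M

------------------------------------------------------------------------
-- Operational semantics

  toℕ : Val Sig [] 𝐍 → ℕ
  toℕ Z     = zero
  toℕ (S V) = suc (toℕ V)

  numeral : ∀ {Γ} → ℕ → Val Sig Γ 𝐍
  numeral zero    = Z
  numeral (suc n) = S (numeral n)

  -- λx. let F (λy. let fix(F) ⇒ z in z y) ⇒ w in w x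

  unroll : ∀ {Γ τ ρ} → Val Sig Γ ((τ ⇒ ρ) ⇒ (τ ⇒ ρ)) → Val Sig Γ (τ ⇒ ρ)
  unroll F =
    ƛ (let-in
        (weaken F ·
          ƛ (let-in (fix (weaken (weaken F)))
                    (var (here refl) · var (there (here refl)))))
        (var (here refl) · var (there (here refl))))

  -- Evaluation of a closed computation up to its first effect operation, at
  -- which it is suspended with one continuation for each child.

  data Outcome (τ : Ty) : Set where
    value  : Val Sig [] τ → Outcome τ
    effect : (l : Label Sig) →
             (∀ i → HasChild (Label.arity l) i → Com Sig [] τ) → Outcome τ

  infix 4 _⇓_

  data _⇓_ : ∀ {τ} → Com Sig [] τ → Outcome τ → Set where
    ⇓app : ∀ {τ ρ} {M : Com Sig (τ ∷ []) ρ} {V o} →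
           M [ V ] ⇓ o → ƛ M · V ⇓ o
    ⇓return : ∀ {τ} {V : Val Sig [] τ} →
              return V ⇓ value V
    ⇓let-value : ∀ {τ ρ} {M : Com Sig [] τ} {N : Com Sig (τ ∷ []) ρ} {V o} →
                 M ⇓ value V → N [ V ] ⇓ o → let-in M N ⇓ o
    ⇓let-effect : ∀ {τ ρ} {M : Com Sig [] τ} {N : Com Sig (τ ∷ []) ρ} {l k} →
                  M ⇓ effect l k →
                  let-in M N ⇓ effect l (λ i h → let-in (k i h) N)
    ⇓fix : ∀ {τ ρ} {F : Val Sig [] ((τ ⇒ ρ) ⇒ (τ ⇒ ρ))} →
           fix F ⇓ value (unroll F)
    ⇓case-Z : ∀ {τ} {M : Com Sig [] τ} {N o} →
              M ⇓ o → case Z M N ⇓ o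
    ⇓case-S : ∀ {τ V} {M : Com Sig [] τ} {N o} →
              N [ V ] ⇓ o → case (S V) M N ⇓ o
    ⇓op-fin : ∀ {τ n σ} {Ms : Vec (Com Sig [] τ) n} →
              op-fin σ Ms ⇓ effect (label σ tt) (λ i i<n → lookup Ms (fromℕ< i<n))
    ⇓op-nat×fin : ∀ {τ n σ V} {Ms : Vec (Com Sig [] τ) n} →
                  op-nat×fin σ V Ms ⇓
                  effect (label σ (toℕ V)) (λ i i<n → lookup Ms (fromℕ< i<n))
    ⇓op-inf : ∀ {τ σ} {V : Val Sig [] (𝐍 ⇒ τ)} →
              op-inf σ V ⇓ effect (label σ tt) (λ i _ → V · numeral i)
    ⇓op-nat×inf : ∀ {τ σ V} {W : Val Sig [] (𝐍 ⇒ τ)} →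
                  op-nat×inf σ V W ⇓
                  effect (label σ (toℕ V)) (λ i _ → W · numeral i)

module _ (em : ExcludedMiddle 0ℓ) {Sig : Signature} where

  -- ⇓ is deterministic, so the outcome picked by em is the only one.

  runAt : ∀ {τ} → Com Sig [] τ → List ℕ → Cell Sig (Val Sig [] τ)
  runAt M p with em {∃ (M ⇓_)}
  runAt M p       | no _                 = bot
  runAt M []      | yes (value V , _)    = leaf V
  runAt M (i ∷ p) | yes (value V , _)    = bot
  runAt M []      | yes (effect l k , _) = node l
  runAt M (i ∷ p) | yes (effect l k , _) with hasChild? (Label.arity l) i
  ... | yes h = runAt (k i h) p
  ... | no  _ = bot

  runAt-wf : ∀ {τ} (M : Com Sig [] τ) p i → runAt M (p ∷ʳ i) ≢ bot →
             ∃[ l ] runAt M p ≡ node l × HasChild (Label.arity l) i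
  runAt-wf M p i ≢bot with em {∃ (M ⇓_)}
  runAt-wf M p       i ≢bot | no _              = contradiction refl ≢bot
  runAt-wf M []      i ≢bot | yes (value V , _) = contradiction refl ≢bot
  runAt-wf M (j ∷ p) i ≢bot | yes (value V , _) = contradiction refl ≢bot
  runAt-wf M []      i ≢bot | yes (effect l k , _) with hasChild? (Label.arity l) i
  ... | yes h = l , refl , h
  ... | no  _ = contradiction refl ≢bot
  runAt-wf M (j ∷ p) i ≢bot | yes (effect l k , _) with hasChild? (Label.arity l) j
  ... | yes h = runAt-wf (k j h) p i ≢bot
  ... | no  _ = contradiction refl ≢bot

  ∣_∣ : ∀ {τ} → Com Sig [] τ → Tree Sig (Val Sig [] τ)
  ∣ M ∣ .at = runAt M
  ∣ M ∣ .wf = runAt-wf M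

------------------------------------------------------------------------
-- Modalities

record Modalities (Sig : Signature) : Set₁ where
  field
    Modality : Set
    ⟦_⟧ₘ     : Modality → Pred (Tree Sig ⊤) 0ℓ

ScottOpen : ∀ {Sig} → Pred (Tree Sig ⊤) 0ℓ → Set
ScottOpen P =
  (∀ {t t′} → t ⊑ t′ → P t → P t′) ×
  (∀ s t → Ascending s → IsSupremum s t → P t → ∃[ n ] P (s n))

module _ {Sig : Signature} (𝒪 : Modalities Sig) where

  open Modalities 𝒪

  AllScottOpen : Set
  AllScottOpen = ∀ o → ScottOpen ⟦ o ⟧ₘ

  -- Excluded middle makes joins and meets indexed by small sets exhaust the
  -- arbitrary ones, as Tree Sig ⊤ and Modality are themselves small.

  data Formula : Set₁ where
    _⟨⊤⟩ _⟨⊥⟩ : Modality → Formula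
    ⋁ ⋀       : {I : Set} → (I → Formula) → Formula

module _ (em : ExcludedMiddle 0ℓ) {Sig : Signature} (𝒪 : Modalities Sig) where

  open Modalities 𝒪

  -- o(A)

  Modal : Modality → ∀ {X} → Pred X 0ℓ → Pred (Tree Sig X) 0ℓ
  Modal o A t = ⟦ o ⟧ₘ (restrict em A t)

  ⟦_⟧ : Formula 𝒪 → Pred (Tree Sig ⊤) 0ℓ
  ⟦ o ⟨⊤⟩ ⟧ = Modal o U
  ⟦ o ⟨⊥⟩ ⟧ = Modal o ∅
  ⟦ ⋁ Φ ⟧   = ⋃ _ (λ i → ⟦ Φ i ⟧)
  ⟦ ⋀ Φ ⟧   = ⋂ _ (λ i → ⟦ Φ i ⟧)

  infix 4 _⊴_ _≼_

  _⊴_ : Tree Sig ⊤ → Tree Sig ⊤ → Set₁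
  t ⊴ t′ = ∀ Φ → ⟦ Φ ⟧ t → ⟦ Φ ⟧ t′

  _≼_ : Tree Sig (Tree Sig ⊤) → Tree Sig (Tree Sig ⊤) → Set₁
  r ≼ r′ = ∀ o Φ → Modal o ⟦ Φ ⟧ r → Modal o ⟦ Φ ⟧ r′

  Decomposable : Set₁
  Decomposable = ∀ r r′ → r ≼ r′ → μ r ⊴ μ r′

------------------------------------------------------------------------
-- Relations on terms

record TermRel (Sig : Signature) (ℓ : Level) (Γ : Ctx) : Set (lsuc ℓ) where
  field
    val : ∀ {τ} → Val Sig Γ τ → Val Sig Γ τ → Set ℓ
    com : ∀ {τ} → Com Sig Γ τ → Com Sig Γ τ → Set ℓ

open TermRel public

ClosedRel : Signature → (ℓ : Level) → Set (lsuc ℓ)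
ClosedRel Sig ℓ = TermRel Sig ℓ []

OpenRel : Signature → (ℓ : Level) → Set (lsuc ℓ)
OpenRel Sig ℓ = ∀ Γ → TermRel Sig ℓ Γ

module _ (em : ExcludedMiddle 0ℓ) {Sig : Signature} (𝒪 : Modalities Sig) where

  image : ∀ {X Y : Set} → REL X Y 0ℓ → Pred X 0ℓ → Pred Y 0ℓ
  image R A y = ∃[ x ] A x × R x y

  -- t 𝒪(R) t′

  Relator : ∀ {X Y : Set} → REL X Y 0ℓ → REL (Tree Sig X) (Tree Sig Y) (lsuc 0ℓ)
  Relator R t t′ = ∀ A o → Modal em 𝒪 o A t → Modal em 𝒪 o (image R A) t′

  record IsSimulation (R : ClosedRel Sig 0ℓ) : Set₁ where
    field
      sim-𝐍   : ∀ {V W : Val Sig [] 𝐍} → val R V W → V ≡ W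
      sim-com : ∀ {τ} {M N : Com Sig [] τ} → com R M N →
                Relator (val R) (∣_∣ em M) (∣_∣ em N)
      sim-⇒   : ∀ {τ ρ} {V W : Val Sig [] (τ ⇒ ρ)} → val R V W →
                ∀ P → com R (V · P) (W · P)

  Similarity : ClosedRel Sig (lsuc 0ℓ)
  Similarity .val V W = Σ[ R ∈ ClosedRel Sig 0ℓ ] IsSimulation R × val R V W
  Similarity .com M N = Σ[ R ∈ ClosedRel Sig 0ℓ ] IsSimulation R × com R M N

module _ {Sig : Signature} {ℓ : Level} where

  OpenExtension : ClosedRel Sig ℓ → OpenRel Sig ℓ
  OpenExtension R Γ .val V W = ∀ (s : Sub Γ []) → val R (subVal s V) (subVal s W)
  OpenExtension R Γ .com M N = ∀ (s : Sub Γ []) → com R (subCom s M) (subCom s N)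

  record Compatible (R : OpenRel Sig ℓ) : Set ℓ where
    field
      c-var : ∀ {Γ τ} (x : τ ∈ Γ) → val (R Γ) (var x) (var x)
      c-⋆   : ∀ {Γ} → val (R Γ) ⋆ ⋆
      c-Z   : ∀ {Γ} → val (R Γ) Z Z
      c-S   : ∀ {Γ V V′} → val (R Γ) V V′ → val (R Γ) (S V) (S V′)
      c-ƛ   : ∀ {Γ τ ρ} {M M′ : Com Sig (τ ∷ Γ) ρ} →
              com (R (τ ∷ Γ)) M M′ → val (R Γ) (ƛ M) (ƛ M′)
      c-app : ∀ {Γ τ ρ} {V V′ : Val Sig Γ (τ ⇒ ρ)} {W W′} →
              val (R Γ) V V′ → val (R Γ) W W′ → com (R Γ) (V · W) (V′ · W′)
      c-return : ∀ {Γ τ} {V V′ : Val Sig Γ τ} →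
                 val (R Γ) V V′ → com (R Γ) (return V) (return V′)
      c-let : ∀ {Γ τ ρ} {M M′ : Com Sig Γ τ} {N N′ : Com Sig (τ ∷ Γ) ρ} →
              com (R Γ) M M′ → com (R (τ ∷ Γ)) N N′ →
              com (R Γ) (let-in M N) (let-in M′ N′)
      c-fix : ∀ {Γ τ ρ} {V V′ : Val Sig Γ ((τ ⇒ ρ) ⇒ (τ ⇒ ρ))} →
              val (R Γ) V V′ → com (R Γ) (fix V) (fix V′)
      c-case : ∀ {Γ τ V V′} {M M′ : Com Sig Γ τ} {N N′} →
               val (R Γ) V V′ → com (R Γ) M M′ → com (R (𝐍 ∷ Γ)) N N′ →
               com (R Γ) (case V M N) (case V′ M′ N′)
      c-op-fin : ∀ {Γ τ n} (σ : Sig (fin n)) {Ms Ms′ : Vec (Com Sig Γ τ) n} →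
                 Pointwise (com (R Γ)) Ms Ms′ →
                 com (R Γ) (op-fin σ Ms) (op-fin σ Ms′)
      c-op-nat×fin : ∀ {Γ τ n} (σ : Sig (nat×fin n)) {V V′}
                     {Ms Ms′ : Vec (Com Sig Γ τ) n} →
                     val (R Γ) V V′ → Pointwise (com (R Γ)) Ms Ms′ →
                     com (R Γ) (op-nat×fin σ V Ms) (op-nat×fin σ V′ Ms′)
      c-op-inf : ∀ {Γ τ} (σ : Sig inf) {V V′ : Val Sig Γ (𝐍 ⇒ τ)} →
                 val (R Γ) V V′ → com (R Γ) (op-inf σ V) (op-inf σ V′)
      c-op-nat×inf : ∀ {Γ τ} (σ : Sig nat×inf) {V V′} {W W′ : Val Sig Γ (𝐍 ⇒ τ)} →
                     val (R Γ) V V′ → val (R Γ) W W′ →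
                     com (R Γ) (op-nat×inf σ V W) (op-nat×inf σ V′ W′)

{-# OPTIONS --safe #-}
-- Howe's method.  The Howe closure of similarity is compatible, substitutive
-- and contains similarity, so it remains to see that on closed terms it is a
-- simulation.  The operational tree ∣ M ∣ is the supremum of approximants that
-- are computed with bounded fuel, and Scott-openness lets the simulation
-- condition be checked on these, by induction on the fuel.  Decomposability
-- makes the relator compatible with flattening, which settles the sequencing
-- case and, by seeing an operation as a tree of depth one, the operation cases.

module Submission where

open import Defs
open import Axiom.ExcludedMiddle using (ExcludedMiddle)
open import Data.Fin.Base using (fromℕ<)
open import Data.List.Base using (List; []; _∷_)
open import Data.List.Membership.Propositional using (_∈_)
open import Data.List.Relation.Unary.Any using (here; there)
open import Data.Nat.Base using (ℕ; zero; suc; _+_)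
open import Data.Nat.Properties using (+-assoc)
open import Data.Product.Base using (∃; ∃-syntax; _×_; _,_; proj₁; proj₂)
open import Data.Sum.Base using (_⊎_; inj₁; inj₂)
open import Data.Unit.Base using (⊤; tt)
open import Data.Vec.Base using (Vec; []; _∷_; lookup)
open import Data.Vec.Relation.Binary.Pointwise.Inductive as Pointwise
  using (Pointwise; []; _∷_)
open import Function.Base using (_∘_)
open import Level using (0ℓ)
open import Relation.Binary.Core using (REL; Rel) renaming (_⇒_ to _⊆ᵣ_)
open import Relation.Binary.Construct.Composition using (_;_)
open import Relation.Binary.PropositionalEquality
  using (_≡_; refl; sym; trans; cong; cong₂; subst; subst₂)
open import Relation.Nullary using (¬_; Dec; yes; no; contradiction)
open import Relation.Nullary.Decidable using (True; toWitness; fromWitness)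
open import Relation.Unary using (Pred; U; ∅; _⊆_)

-- Effect trees

-- Sequencing is the obstacle: the relator compares trees through predicates on their leaves,
-- whereas after a bind each leaf carries a whole tree. The predicates that bridge the two levels
-- have the form "the restricted continuation satisfies a formula". The relator may be applied to
-- any predicate, so it applies to these, and trees related by the relator satisfy corresponding
-- formulas because `o ⟨⊤⟩` and `o ⟨⊥⟩` are the relator condition at a given predicate and at the
-- empty one. Scott-openness acts on the left argument of the relator only. Hence only the left
-- computation is approximated and the right one keeps its full tree, so the two sides need not
-- evaluate in step. Similarity quantifies over relations and lies one universe above the
-- simulations of which it is the union. The Howe closure must itself be one of these simulations,
-- so it is built over a small copy of similarity. Trees are compared position by position.

module _ {Sig : Signature} where

  infix 4 _≈_ _≲_

  _≈_ : ∀ {X} → Tree Sig X → Tree Sig X → Set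
  t ≈ u = ∀ p → at t p ≡ at u p

  -- Stated for labellings rather than trees, since Agda does not recover the
  -- field wf from t ≈ u or t ⊑ u.

  module _ {X : Set} {t u : List ℕ → Cell Sig X} where

    ≈-sym : (∀ p → t p ≡ u p) → ∀ p → u p ≡ t p
    ≈-sym t≈u p = sym (t≈u p)

    ≈⇒⊑ : (∀ p → t p ≡ u p) → ∀ p → t p ≡ bot ⊎ t p ≡ u p
    ≈⇒⊑ t≈u p = inj₂ (t≈u p)

    ≈-trans : ∀ {v : List ℕ → Cell Sig X} → (∀ p → t p ≡ u p) →
              (∀ p → u p ≡ v p) → ∀ p → t p ≡ v p
    ≈-trans t≈u u≈v p = trans (t≈u p) (u≈v p)

    ⊑-trans : ∀ {v : List ℕ → Cell Sig X} → (∀ p → t p ≡ bot ⊎ t p ≡ u p) →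
              (∀ p → u p ≡ bot ⊎ u p ≡ v p) → ∀ p → t p ≡ bot ⊎ t p ≡ v p
    ⊑-trans t⊑u u⊑v p with t⊑u p | u⊑v p
    ... | inj₁ t≡⊥ | _        = inj₁ t≡⊥
    ... | inj₂ t≡u | inj₁ u≡⊥ = inj₁ (trans t≡u u≡⊥)
    ... | inj₂ t≡u | inj₂ u≡v = inj₂ (trans t≡u u≡v)

  ⊑-refl : ∀ {X} {t : List ℕ → Cell Sig X} → ∀ p → t p ≡ bot ⊎ t p ≡ t p
  ⊑-refl p = inj₂ refl

  botT : ∀ {X} → Tree Sig X
  botT .at p          = bot
  botT .wf p i ≢bot = contradiction refl ≢bot

  leafAt : ∀ {X} → X → List ℕ → Cell Sig X
  leafAt x []      = leaf x
  leafAt x (_ ∷ _) = bot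

  leafT : ∀ {X} → X → Tree Sig X
  leafT x .at                = leafAt x
  leafT x .wf []      i ≢bot = contradiction refl ≢bot
  leafT x .wf (_ ∷ _) i ≢bot = contradiction refl ≢bot

  nodeAt : ∀ {X} (l : Label Sig) →
           (∀ i → HasChild (Label.arity l) i → Tree Sig X) → List ℕ → Cell Sig X
  nodeAt l ts []      = node l
  nodeAt l ts (i ∷ p) with hasChild? (Label.arity l) i
  ... | yes h = at (ts i h) p
  ... | no  _ = bot

  nodeT : ∀ {X} (l : Label Sig) →
          (∀ i → HasChild (Label.arity l) i → Tree Sig X) → Tree Sig X
  nodeT l ts .at = nodeAt l ts
  nodeT l ts .wf [] i ≢bot with hasChild? (Label.arity l) i
  ... | yes h = l , refl , h
  ... | no  _ = contradiction refl ≢bot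
  nodeT l ts .wf (j ∷ p) i ≢bot with hasChild? (Label.arity l) j
  ... | yes h = wf (ts j h) p i ≢bot
  ... | no  _ = contradiction refl ≢bot

  nodeT-mono : ∀ {X} {l : Label Sig}
               {ts us : ∀ i → HasChild (Label.arity l) i → Tree Sig X} →
               (∀ i h → ts i h ⊑ us i h) → nodeT l ts ⊑ nodeT l us
  nodeT-mono         ts⊑us []      = inj₂ refl
  nodeT-mono {l = l} ts⊑us (i ∷ p) with hasChild? (Label.arity l) i
  ... | yes h = ts⊑us i h p
  ... | no  _ = inj₁ refl

  mapCell : ∀ {X Y} → (X → Y) → Cell Sig X → Cell Sig Y
  mapCell f bot      = bot
  mapCell f (leaf x) = leaf (f x)
  mapCell f (node l) = node l

  mapT : ∀ {X Y} → (X → Y) → Tree Sig X → Tree Sig Y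
  mapT f t .at p = mapCell f (at t p)
  mapT f t .wf p i ≢bot with wf t p i (≢bot ∘ cong (mapCell f))
  ... | l , eq , h = l , cong (mapCell f) eq , h

  bindT : ∀ {X Y} → Tree Sig X → (X → Tree Sig Y) → Tree Sig Y
  bindT t f = μ (mapT f t)

  -- On trees of trees `⊑` would force the trees at corresponding leaves to be equal, which is too
  -- strict for a bind whose continuations grow. Here they may grow as well.
  data _≲_ {X} : Rel (Cell Sig (Tree Sig X)) 0ℓ where
    bot≲ : ∀ {c} → bot ≲ c
    leaf : ∀ {u v} → u ⊑ v → leaf u ≲ leaf v
    node : ∀ {l} → node l ≲ node l

  flatten-mono : ∀ {X} {r r′ : List ℕ → Cell Sig (Tree Sig X)} →
                 (∀ p → r p ≲ r′ p) →
                 ∀ p → flatten r p ≡ bot ⊎ flatten r p ≡ flatten r′ p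
  flatten-mono {r = r} {r′} r≲r′ p with r [] | r′ [] | r≲r′ []
  flatten-mono r≲r′ p       | _ | _ | bot≲     = inj₁ refl
  flatten-mono r≲r′ p       | _ | _ | leaf u⊑v = u⊑v p
  flatten-mono r≲r′ []      | _ | _ | node     = inj₂ refl
  flatten-mono r≲r′ (i ∷ p) | _ | _ | node     =
    flatten-mono (λ q → r≲r′ (i ∷ q)) p

  mapCell-mono : ∀ {X Y} {f g : X → Tree Sig Y} → (∀ x → f x ⊑ g x) →
                 ∀ c → mapCell f c ≲ mapCell g c
  mapCell-mono f⊑g bot      = bot≲
  mapCell-mono f⊑g (leaf x) = leaf (f⊑g x)
  mapCell-mono f⊑g (node l) = node

  bindT-mono : ∀ {X Y} (t u : Tree Sig X) {f g : X → Tree Sig Y} → t ⊑ u →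
               (∀ x → f x ⊑ g x) → bindT t f ⊑ bindT u g
  bindT-mono t u {f} {g} t⊑u f⊑g = flatten-mono cells
    where
    cells : ∀ p → mapCell f (at t p) ≲ mapCell g (at u p)
    cells p with at t p | t⊑u p
    ... | _ | inj₁ refl = bot≲
    ... | _ | inj₂ refl = mapCell-mono f⊑g (at u p)

  flatten-cong : ∀ {X} {r r′ : List ℕ → Cell Sig (Tree Sig X)} →
                 (∀ p → r p ≡ r′ p) → ∀ p → flatten r p ≡ flatten r′ p
  flatten-cong {r = r} {r′} r≡r′ p with r [] | r′ [] | r≡r′ []
  flatten-cong r≡r′ p       | bot    | _ | refl = refl
  flatten-cong r≡r′ p       | leaf u | _ | refl = refl
  flatten-cong r≡r′ []      | node l | _ | refl = refl
  flatten-cong r≡r′ (i ∷ p) | node l | _ | refl =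
    flatten-cong (λ q → r≡r′ (i ∷ q)) p

  bindT-congˡ : ∀ {X Y} (t u : Tree Sig X) {f : X → Tree Sig Y} →
                t ≈ u → bindT t f ≈ bindT u f
  bindT-congˡ t u {f} t≈u = flatten-cong (λ p → cong (mapCell f) (t≈u p))

  bindT-nodeT : ∀ {X Y} {l : Label Sig}
                {ts : ∀ i → HasChild (Label.arity l) i → Tree Sig X}
                {f : X → Tree Sig Y} →
                bindT (nodeT l ts) f ≈ nodeT l (λ i h → bindT (ts i h) f)
  bindT-nodeT         []      = refl
  bindT-nodeT {l = l} (i ∷ p) with hasChild? (Label.arity l) i
  ... | yes h = refl
  ... | no  _ = refl

  -- As Cell is flat, this is what suprema of ascending chains amount to; it is
  -- visibly preserved by restriction.

  IsPointwiseSup : ∀ {X} → (ℕ → Tree Sig X) → Tree Sig X → Set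
  IsPointwiseSup s t =
    (∀ n → s n ⊑ t) × (∀ p → at t p ≡ bot ⊎ ∃[ n ] at (s n) p ≡ at t p)

  pointwiseSup⇒sup : ∀ {X} {s : ℕ → Tree Sig X} {t} →
                     IsPointwiseSup s t → IsSupremum s t
  pointwiseSup⇒sup {s = s} {t} (bound , attained) = bound , least
    where
    least : ∀ u → (∀ n → s n ⊑ u) → t ⊑ u
    least u s⊑u p with attained p
    ... | inj₁ t≡⊥       = inj₁ t≡⊥
    ... | inj₂ (n , s≡t) with s⊑u n p
    ...   | inj₁ s≡⊥ = inj₁ (trans (sym s≡t) s≡⊥)
    ...   | inj₂ s≡u = inj₂ (trans (sym s≡t) s≡u)

-- Restriction of trees to a predicate

module _ (em : ExcludedMiddle 0ℓ) {Sig : Signature} where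

  restrictCell-mono : ∀ {X} {A B : Pred X 0ℓ} → A ⊆ B → (c : Cell Sig X) →
                      restrictCell em A c ≡ bot ⊎
                      restrictCell em A c ≡ restrictCell em B c
  restrictCell-mono         A⊆B bot      = inj₁ refl
  restrictCell-mono         A⊆B (node l) = inj₂ refl
  restrictCell-mono {A = A} {B} A⊆B (leaf x) with em {A x} | em {B x}
  ... | no  _ | _     = inj₁ refl
  ... | yes _ | yes _ = inj₂ refl
  ... | yes a | no ¬b = contradiction (A⊆B a) ¬b

  restrict-mono : ∀ {X} {A B : Pred X 0ℓ} {t u : Tree Sig X} →
                  A ⊆ B → t ⊑ u → restrict em A t ⊑ restrict em B u
  restrict-mono {A = A} {u = u} A⊆B t⊑u p with t⊑u p
  ... | inj₁ t≡⊥ = inj₁ (cong (restrictCell em A) t≡⊥)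
  ... | inj₂ t≡u =
    subst (λ c → restrictCell em A c ≡ bot ⊎ restrictCell em A c ≡ _)
      (sym t≡u) (restrictCell-mono A⊆B (at u p))

  restrict-mapT : ∀ {X Y} (A : Pred Y 0ℓ) (f : X → Y) (t : Tree Sig X) →
                  restrict em A (mapT f t) ≈ restrict em (A ∘ f) t
  restrict-mapT A f t p with at t p
  ... | bot    = refl
  ... | node l = refl
  ... | leaf x with em {A (f x)}
  ...   | yes _ = refl
  ...   | no  _ = refl

  restrict-U : ∀ (t : Tree Sig ⊤) → restrict em U t ≈ t
  restrict-U t p with at t p
  ... | bot    = refl
  ... | node l = refl
  ... | leaf x with em {U x}
  ...   | yes _ = refl
  ...   | no ¬u = contradiction tt ¬u

  restrict-∅ : ∀ {X} (A : Pred X 0ℓ) (t : Tree Sig X) →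
               restrict em ∅ (restrict em A t) ≈ restrict em ∅ t
  restrict-∅ A t p with at t p
  ... | bot    = refl
  ... | node l = refl
  ... | leaf x with em {A x} | em {∅ x}
  ...   | _     | yes ()
  ...   | no  _ | no _ = refl
  ...   | yes _ | no _ with em {∅ tt}
  ...     | no _ = refl

  -- The second labelling is tied to the first only pointwise. `restrict-bindT` can thus identify
  -- mapping twice with mapping a composite, and the recursion can pass to subtrees.
  restrict-flatten : ∀ {X} (A : Pred X 0ℓ) {r : List ℕ → Cell Sig (Tree Sig X)} {r′} →
                     (∀ p → r′ p ≡ mapCell (restrict em A) (r p)) →
                     ∀ p → restrictCell em A (flatten r p) ≡ flatten r′ p
  restrict-flatten A {r} {r′} eqs p with r [] | r′ [] | eqs []
  restrict-flatten A eqs p       | bot    | _ | refl = refl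
  restrict-flatten A eqs p       | leaf u | _ | refl = refl
  restrict-flatten A eqs []      | node l | _ | refl = refl
  restrict-flatten A eqs (i ∷ p) | node l | _ | refl =
    restrict-flatten A (λ q → eqs (i ∷ q)) p

  restrict-bindT : ∀ {X Y} (A : Pred Y 0ℓ) (t : Tree Sig X) (f : X → Tree Sig Y) →
                   restrict em A (bindT t f) ≈ bindT t (restrict em A ∘ f)
  restrict-bindT A t f = restrict-flatten A (λ p → mapCell-∘ (at t p))
    where
    mapCell-∘ : ∀ c → mapCell (restrict em A ∘ f) c ≡
                      mapCell (restrict em A) (mapCell f c)
    mapCell-∘ bot      = refl
    mapCell-∘ (leaf x) = refl
    mapCell-∘ (node l) = refl

  restrict-pointwiseSup : ∀ {X} (A : Pred X 0ℓ) {s : ℕ → Tree Sig X} {t} →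
                          IsPointwiseSup s t →
                          IsPointwiseSup (restrict em A ∘ s) (restrict em A t)
  restrict-pointwiseSup A {s} {t} (bound , attained) =
    (λ n → restrict-mono {t = s n} {t} (λ a → a) (bound n)) , attained′
    where
    attained′ : ∀ p → restrictCell em A (at t p) ≡ bot ⊎
                ∃[ n ] restrictCell em A (at (s n) p) ≡ restrictCell em A (at t p)
    attained′ p with attained p
    ... | inj₁ t≡⊥       = inj₁ (cong (restrictCell em A) t≡⊥)
    ... | inj₂ (n , s≡t) = inj₂ (n , cong (restrictCell em A) s≡t)

-- The relator

module RelatorLaws (em : ExcludedMiddle 0ℓ) {Sig : Signature} (𝒪 : Modalities Sig)
         (scott : AllScottOpen 𝒪) (decomposable : Decomposable em 𝒪) where

  -- Relator wrapped so that Agda recovers R, t and u from the type.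

  record Related {X Y : Set} (R : REL X Y 0ℓ)
                 (t : Tree Sig X) (u : Tree Sig Y) : Set₁ where
    constructor related
    field
      relator : Relator em 𝒪 R t u

  open Related public

  -- Combined with `≈⇒⊑`, this is also what makes a modality respect pointwise equality of trees.
  modality-mono : ∀ o t u → t ⊑ u →
                  Modalities.⟦_⟧ₘ 𝒪 o t → Modalities.⟦_⟧ₘ 𝒪 o u
  modality-mono o t u = proj₁ (scott o) {t} {u}

  Modal-mono : ∀ {X} o {A B : Pred X 0ℓ} (t u : Tree Sig X) → A ⊆ B → t ⊑ u →
               Modal em 𝒪 o A t → Modal em 𝒪 o B u
  Modal-mono o t u A⊆B t⊑u = modality-mono o _ _ (restrict-mono em {t = t} {u} A⊆B t⊑u)

  related-mono : ∀ {X Y} {R Q : REL X Y 0ℓ} {t u} →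
                 R ⊆ᵣ Q → Related R t u → Related Q t u
  related-mono {u = u} R⊆Q tRu .relator A o t∈oA =
    Modal-mono o u u (λ (x , a , xRy) → x , a , R⊆Q xRy) ⊑-refl
      (tRu .relator A o t∈oA)

  related-⊑ : ∀ {X Y} {R : REL X Y 0ℓ} {t t′ u u′} →
              t ⊑ t′ → Related R t′ u′ → u′ ⊑ u → Related R t u
  related-⊑ {t = t} {t′} {u} {u′} t⊑t′ t′Ru′ u′⊑u .relator A o t∈oA =
    Modal-mono o u′ u (λ a → a) u′⊑u
      (t′Ru′ .relator A o (Modal-mono o t t′ (λ a → a) t⊑t′ t∈oA))

  related-refl : ∀ {X} {R : Rel X 0ℓ} {t} → (∀ {x} → R x x) → Related R t t
  related-refl {t = t} R-refl .relator A o =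
    Modal-mono o t t (λ a → _ , a , R-refl) ⊑-refl

  related-trans : ∀ {X Y Z} {R : REL X Y 0ℓ} {Q : REL Y Z 0ℓ} {t u v} →
                  Related R t u → Related Q u v → Related (R ; Q) t v
  related-trans {R = R} {v = v} tRu uQv .relator A o t∈oA =
    Modal-mono o v v (λ (y , (x , a , xRy) , yQz) → x , a , y , xRy , yQz) ⊑-refl
      (uQv .relator (image em 𝒪 R A) o (tRu .relator A o t∈oA))

  related-botT : ∀ {X Y} {R : REL X Y 0ℓ} {u} → Related R botT u
  related-botT .relator A o = modality-mono o _ _ (λ _ → inj₁ refl)

  related-leafT : ∀ {X Y} {R : REL X Y 0ℓ} {x y} → R x y →
                  Related R (leafT x) (leafT y)
  related-leafT {R = R} {x} {y} xRy .relator A o = modality-mono o _ _ cells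
    where
    cells : restrict em A (leafT x) ⊑ restrict em (image em 𝒪 R A) (leafT y)
    cells (_ ∷ _) = inj₁ refl
    cells [] with em {A x} | em {image em 𝒪 R A y}
    ... | no  _ | _     = inj₁ refl
    ... | yes _ | yes _ = inj₂ refl
    ... | yes a | no ¬b = contradiction (x , a , xRy) ¬b

  related-sup : ∀ {X Y} {R : REL X Y 0ℓ} {s t u} →
                Ascending s → IsPointwiseSup s t →
                (∀ n → Related R (s n) u) → Related R t u
  related-sup {s = s} {t} ascending sup sRu .relator A o t∈oA
    with proj₂ (scott o) (restrict em A ∘ s) (restrict em A t)
           (λ n → restrict-mono em {t = s n} {s (suc n)} (λ a → a) (ascending n))
           (pointwiseSup⇒sup {s = restrict em A ∘ s} {restrict em A t}
             (restrict-pointwiseSup em A {s} {t} sup))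
           t∈oA
  ... | n , sₙ∈oA = sRu n .relator A o sₙ∈oA

  -- Induction on the formula. At `o ⟨⊤⟩` a second restriction changes nothing, which leaves the
  -- relator at `A`. At `o ⟨⊥⟩` all leaves are erased, which leaves the relator at `∅`, whose image
  -- is empty. Joins and meets go through index by index.
  related⇒⊴ : ∀ {X Y} {R : REL X Y 0ℓ} {t u} → Related R t u → ∀ A →
              _⊴_ em 𝒪 (restrict em A t) (restrict em (image em 𝒪 R A) u)
  related⇒⊴ {R = R} {t} {u} tRu A (o ⟨⊤⟩) t∈ =
    modality-mono o _ _ (≈⇒⊑ (≈-sym (restrict-U em (restrict em (image em 𝒪 R A) u))))
      (tRu .relator A o
        (modality-mono o _ _ (≈⇒⊑ (restrict-U em (restrict em A t))) t∈))
  related⇒⊴ {R = R} {t} {u} tRu A (o ⟨⊥⟩) t∈ =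
    modality-mono o _ _ (≈⇒⊑ (≈-sym (restrict-∅ em (image em 𝒪 R A) u)))
      (Modal-mono o u u (λ ()) ⊑-refl
        (tRu .relator ∅ o (modality-mono o _ _ (≈⇒⊑ (restrict-∅ em A t)) t∈)))
  related⇒⊴ tRu A (⋁ Φ) (i , t∈) = i , related⇒⊴ tRu A (Φ i) t∈
  related⇒⊴ tRu A (⋀ Φ) t∈ i     = related⇒⊴ tRu A (Φ i) (t∈ i)

  -- Restriction commutes with bind, so membership of the composite in `o(A)` says that flattening a
  -- tree of trees over `⊤` yields an element of `o ⟨⊤⟩`. Decomposability then reduces the claim to
  -- `r ≼ r′`.
  related-bindT : ∀ {X Y X′ Y′} {R : REL X Y 0ℓ} {Q : REL X′ Y′ 0ℓ}
                  (t : Tree Sig X) (f : X → Tree Sig X′)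
                  (u : Tree Sig Y) (g : Y → Tree Sig Y′) →
                  Related R t u → (∀ {x y} → R x y → Related Q (f x) (g y)) →
                  Related Q (bindT t f) (bindT u g)
  related-bindT {Q = Q} t f u g tRu fQg .relator A o t∈oA =
    modality-mono o _ _
      (≈⇒⊑ (≈-trans (restrict-U em (μ r′)) (≈-sym (restrict-bindT em B u g))))
      (decomposable r r′ r≼r′ (o ⟨⊤⟩)
        (modality-mono o _ _
          (≈⇒⊑ (≈-trans (restrict-bindT em A t f) (≈-sym (restrict-U em (μ r)))))
          t∈oA))
    where
    B  = image em 𝒪 Q A
    r  = mapT (restrict em A ∘ f) t
    r′ = mapT (restrict em B ∘ g) u
    -- The predicate given to the relator collects the leaves whose restricted continuation
    -- satisfies `Φ`; on its image `related⇒⊴` transfers `Φ` to the other side.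
    r≼r′ : _≼_ em 𝒪 r r′
    r≼r′ o Φ r∈ =
      modality-mono o _ _
        (≈⇒⊑ (≈-sym (restrict-mapT em (⟦_⟧ em 𝒪 Φ) (restrict em B ∘ g) u)))
        (Modal-mono o u u (λ (x , φ , xRy) → related⇒⊴ (fQg xRy) A Φ φ) ⊑-refl
          (tRu .relator (⟦_⟧ em 𝒪 Φ ∘ restrict em A ∘ f) o
            (modality-mono o _ _
              (≈⇒⊑ (restrict-mapT em (⟦_⟧ em 𝒪 Φ) (restrict em A ∘ f) t)) r∈)))

  -- The node is a bind whose outer tree, with the child indices as leaves, is the same on both
  -- sides. That tree is related to itself by `_≡_`, so only the children have to be compared.
  related-nodeT : ∀ {X Y} {R : REL X Y 0ℓ} {l : Label Sig} ts us →
                  (∀ i h → Related R (ts i h) (us i h)) →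
                  Related R (nodeT l ts) (nodeT l us)
  related-nodeT {l = l} ts us tsRus =
    related-⊑ (≈⇒⊑ (≈-sym (bind-children ts)))
      (related-bindT {R = _≡_} children (λ (i , h) → ts i h)
        children (λ (i , h) → us i h)
        (related-refl refl) (λ { {i , h} refl → tsRus i h }))
      (≈⇒⊑ (bind-children us))
    where
    children : Tree Sig (∃ (HasChild (Label.arity l)))
    children = nodeT l (λ i h → leafT (i , h))
    bind-children : ∀ {Z} (vs : ∀ i → HasChild (Label.arity l) i → Tree Sig Z) →
                    bindT children (λ (i , h) → vs i h) ≈ nodeT l vs
    bind-children vs []      = refl
    bind-children vs (i ∷ p) with hasChild? (Label.arity l) i
    ... | yes h = refl
    ... | no  _ = refl

-- Operational trees and their approximants

module _ {Sig : Signature} where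

  ⇓-deterministic : ∀ {τ} {M : Com Sig [] τ} {o o′} → M ⇓ o → M ⇓ o′ → o ≡ o′
  ⇓-deterministic (⇓app d)     (⇓app d′)    = ⇓-deterministic d d′
  ⇓-deterministic ⇓return      ⇓return      = refl
  ⇓-deterministic (⇓let-value d e) (⇓let-value d′ e′) with ⇓-deterministic d d′
  ... | refl = ⇓-deterministic e e′
  ⇓-deterministic (⇓let-value d e) (⇓let-effect d′) with ⇓-deterministic d d′
  ... | ()
  ⇓-deterministic (⇓let-effect d) (⇓let-value d′ e′) with ⇓-deterministic d d′
  ... | ()
  ⇓-deterministic (⇓let-effect d) (⇓let-effect d′) with ⇓-deterministic d d′
  ... | refl = refl
  ⇓-deterministic ⇓fix         ⇓fix         = refl
  ⇓-deterministic (⇓case-Z d)  (⇓case-Z d′) = ⇓-deterministic d d′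
  ⇓-deterministic (⇓case-S d)  (⇓case-S d′) = ⇓-deterministic d d′
  ⇓-deterministic ⇓op-fin      ⇓op-fin      = refl
  ⇓-deterministic ⇓op-nat×fin  ⇓op-nat×fin  = refl
  ⇓-deterministic ⇓op-inf      ⇓op-inf      = refl
  ⇓-deterministic ⇓op-nat×inf  ⇓op-nat×inf  = refl

  outcomeT : ∀ {τ} → (Com Sig [] τ → Tree Sig (Val Sig [] τ)) →
             Outcome τ → Tree Sig (Val Sig [] τ)
  outcomeT run (value V)    = leafT V
  outcomeT run (effect l k) = nodeT l (λ i h → run (k i h))

  -- Fuel drops at every recursive call, below effects as well, which makes the recursion
  -- structural. The clause for `let-in` is literally a bind, the form that `related-bindT` treats.
  approx : ∀ {τ} → ℕ → Com Sig [] τ → Tree Sig (Val Sig [] τ)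
  approx zero    M                   = botT
  approx (suc n) (ƛ M · V)           = approx n (M [ V ])
  approx (suc n) (return V)          = leafT V
  approx (suc n) (let-in M N)        = bindT (approx n M) (λ V → approx n (N [ V ]))
  approx (suc n) (fix F)             = leafT (unroll F)
  approx (suc n) (case Z M N)        = approx n M
  approx (suc n) (case (S V) M N)    = approx n (N [ V ])
  approx (suc n) (op-fin σ Ms)       =
    nodeT (label σ tt) (λ i h → approx n (lookup Ms (fromℕ< h)))
  approx (suc n) (op-nat×fin σ V Ms) =
    nodeT (label σ (toℕ V)) (λ i h → approx n (lookup Ms (fromℕ< h)))
  approx (suc n) (op-inf σ V)        =
    nodeT (label σ tt) (λ i h → approx n (V · numeral i))
  approx (suc n) (op-nat×inf σ V W)  =
    nodeT (label σ (toℕ V)) (λ i h → approx n (W · numeral i))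

  approx-ascending : ∀ {τ} (M : Com Sig [] τ) → Ascending (λ n → approx n M)
  approx-ascending M                   zero    = λ _ → inj₁ refl
  approx-ascending (ƛ M · V)           (suc n) = approx-ascending (M [ V ]) n
  approx-ascending (return V)          (suc n) = ⊑-refl
  approx-ascending (let-in M N)        (suc n) =
    bindT-mono (approx n M) (approx (suc n) M) (approx-ascending M n)
      (λ V → approx-ascending (N [ V ]) n)
  approx-ascending (fix F)             (suc n) = ⊑-refl
  approx-ascending (case Z M N)        (suc n) = approx-ascending M n
  approx-ascending (case (S V) M N)    (suc n) = approx-ascending (N [ V ]) n
  approx-ascending (op-fin σ Ms)       (suc n) =
    nodeT-mono (λ i h → approx-ascending (lookup Ms (fromℕ< h)) n)
  approx-ascending (op-nat×fin σ V Ms) (suc n) =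
    nodeT-mono (λ i h → approx-ascending (lookup Ms (fromℕ< h)) n)
  approx-ascending (op-inf σ V)        (suc n) =
    nodeT-mono (λ i h → approx-ascending (V · numeral i) n)
  approx-ascending (op-nat×inf σ V W)  (suc n) =
    nodeT-mono (λ i h → approx-ascending (W · numeral i) n)

  approx-+ : ∀ {τ} (M : Com Sig [] τ) m n → approx n M ⊑ approx (m + n) M
  approx-+ M zero    n = ⊑-refl
  approx-+ M (suc m) n = ⊑-trans (approx-+ M m n) (approx-ascending M (m + n))

  -- Here `n` pays for reaching the outcome, and an arbitrary remainder `m` is left for the children
  -- of an effect. Without this remainder the bound would see no further than the first effect.
  ⇓⇒approx : ∀ {τ} {M : Com Sig [] τ} {o} → M ⇓ o →
             ∃[ n ] ∀ m → outcomeT (approx m) o ⊑ approx (n + m) M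
  ⇓⇒approx (⇓app d) with ⇓⇒approx d
  ... | n , bound = suc n , bound
  ⇓⇒approx ⇓return = 1 , λ m → ⊑-refl
  ⇓⇒approx (⇓let-value {M = M} {N} {V} {o} d e) with ⇓⇒approx d | ⇓⇒approx e
  ... | n₁ , bound₁ | n₂ , bound₂ = suc (n₁ + n₂) , bound
    where
    bound : ∀ m → outcomeT (approx m) o ⊑ approx (suc (n₁ + n₂) + m) (let-in M N)
    bound m rewrite +-assoc n₁ n₂ m =
      -- Both parts of a `let-in` receive the same fuel: `M` needs `n₁` and leaves the rest over,
      -- and the continuation, which needs `n₂`, is padded by `n₁`.
      ⊑-trans (bound₂ m)
        (⊑-trans (approx-+ (N [ V ]) n₁ (n₂ + m))
          (bindT-mono (leafT V) (approx (n₁ + (n₂ + m)) M)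
            {λ V → approx (n₁ + (n₂ + m)) (N [ V ])}
            (bound₁ (n₂ + m)) (λ _ → ⊑-refl)))
  ⇓⇒approx (⇓let-effect {M = M} {N} {l} {k} d) with ⇓⇒approx d
  ... | n , bound = suc n , λ m →
    -- One more unit of fuel unfolds the `let-in` in each child into a bind, which can then be
    -- pulled out of the node.
    ⊑-trans (nodeT-mono (λ i h → approx-ascending (let-in (k i h) N) m))
      (⊑-trans (≈⇒⊑ (≈-sym (bindT-nodeT {ts = λ i h → approx m (k i h)})))
        (bindT-mono (nodeT l (λ i h → approx m (k i h))) (approx (n + m) M)
          (bound m) (λ V → approx-+ (N [ V ]) n m)))
  ⇓⇒approx ⇓fix = 1 , λ m → ⊑-refl
  ⇓⇒approx (⇓case-Z d) with ⇓⇒approx d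
  ... | n , bound = suc n , bound
  ⇓⇒approx (⇓case-S d) with ⇓⇒approx d
  ... | n , bound = suc n , bound
  ⇓⇒approx ⇓op-fin     = 1 , λ m → ⊑-refl
  ⇓⇒approx ⇓op-nat×fin = 1 , λ m → ⊑-refl
  ⇓⇒approx ⇓op-inf     = 1 , λ m → ⊑-refl
  ⇓⇒approx ⇓op-nat×inf = 1 , λ m → ⊑-refl

module OperationalTrees (em : ExcludedMiddle 0ℓ) {Sig : Signature} where

  run-⇓ : ∀ {τ} {M : Com Sig [] τ} {o} → M ⇓ o → ∣_∣ em M ≈ outcomeT (∣_∣ em) o
  run-⇓ {M = M} d p with em {∃ (M ⇓_)}
  run-⇓ d p | no ¬d = contradiction (_ , d) ¬d
  run-⇓ d p | yes (_ , d′) with ⇓-deterministic d d′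
  run-⇓ d []      | yes (value V , _)    | refl = refl
  run-⇓ d (i ∷ p) | yes (value V , _)    | refl = refl
  run-⇓ d []      | yes (effect l k , _) | refl = refl
  run-⇓ d (i ∷ p) | yes (effect l k , _) | refl with hasChild? (Label.arity l) i
  ... | yes h = refl
  ... | no  _ = refl

  run-⇑ : ∀ {τ} {M : Com Sig [] τ} → ¬ ∃ (M ⇓_) → ∣_∣ em M ≈ botT
  run-⇑ {M = M} ¬d p with em {∃ (M ⇓_)}
  ... | no  _ = refl
  ... | yes d = contradiction d ¬d

  run-cong : ∀ {τ} {M N : Com Sig [] τ} → (∀ {o} → M ⇓ o → N ⇓ o) →
             (∀ {o} → N ⇓ o → M ⇓ o) → ∣_∣ em M ≈ ∣_∣ em N
  -- Splitting on an argument, not by `with`, keeps both trees in the form on which `run-⇓` and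
  -- `run-⇑` act.
  run-cong {M = M} {N} M⇒N N⇒M = by-outcome em
    where
    by-outcome : Dec (∃ (M ⇓_)) → ∣_∣ em M ≈ ∣_∣ em N
    by-outcome (yes (o , d)) = ≈-trans (run-⇓ d) (≈-sym (run-⇓ (M⇒N d)))
    by-outcome (no ¬d)       =
      ≈-trans (run-⇑ ¬d) (≈-sym (run-⇑ (λ (o , d) → ¬d (o , N⇒M d))))

  run-app : ∀ {τ ρ} {M : Com Sig (τ ∷ []) ρ} {V} →
            ∣_∣ em (M [ V ]) ≈ ∣_∣ em (ƛ M · V)
  run-app = run-cong ⇓app (λ { (⇓app d) → d })

  run-case-Z : ∀ {τ} {M : Com Sig [] τ} {N} → ∣_∣ em M ≈ ∣_∣ em (case Z M N)
  run-case-Z = run-cong ⇓case-Z (λ { (⇓case-Z d) → d })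

  run-case-S : ∀ {τ} {M : Com Sig [] τ} {N V} →
               ∣_∣ em (N [ V ]) ≈ ∣_∣ em (case (S V) M N)
  run-case-S = run-cong ⇓case-S (λ { (⇓case-S d) → d })

  let-⇓ : ∀ {τ ρ} {M : Com Sig [] τ} {N : Com Sig (τ ∷ []) ρ} {V o} →
          M ⇓ value V → let-in M N ⇓ o → N [ V ] ⇓ o
  let-⇓ d (⇓let-value d′ e) with ⇓-deterministic d d′
  ... | refl = e
  let-⇓ d (⇓let-effect d′) with ⇓-deterministic d d′
  ... | ()

  -- Induction on the position. When `M` stops at an effect, the `let-in` moves into the children,
  -- where the remaining position is shorter; the other outcomes need no recursion.
  run-let : ∀ {τ ρ} (M : Com Sig [] τ) (N : Com Sig (τ ∷ []) ρ) →
            bindT (∣_∣ em M) (λ V → ∣_∣ em (N [ V ])) ≈ ∣_∣ em (let-in M N)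
  run-let M N p = by-outcome p em
    where
    by-outcome : ∀ p → Dec (∃ (M ⇓_)) →
                 at (bindT (∣_∣ em M) (λ V → ∣_∣ em (N [ V ]))) p ≡
                 at (∣_∣ em (let-in M N)) p
    by-outcome p (no ¬d) =
      trans (bindT-congˡ (∣_∣ em M) botT (run-⇑ ¬d) p) (sym (run-⇑ diverges p))
      where
      diverges : ¬ ∃ (let-in M N ⇓_)
      diverges (_ , ⇓let-value d _) = ¬d (_ , d)
      diverges (_ , ⇓let-effect d)  = ¬d (_ , d)
    by-outcome p (yes (value V , d)) =
      trans (bindT-congˡ (∣_∣ em M) (leafT V) (run-⇓ d) p)
        (run-cong (⇓let-value d) (let-⇓ d) p)
    by-outcome p (yes (effect l k , d)) =
      trans (bindT-congˡ (∣_∣ em M) (nodeT l (λ i h → ∣_∣ em (k i h))) (run-⇓ d) p)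
        (trans (bindT-nodeT {ts = λ i h → ∣_∣ em (k i h)} p)
          (trans (children p) (sym (run-⇓ (⇓let-effect d) p))))
      where
      children : ∀ p → nodeAt l (λ i h → bindT (∣_∣ em (k i h)) (λ V → ∣_∣ em (N [ V ]))) p ≡
                       nodeAt l (λ i h → ∣_∣ em (let-in (k i h) N)) p
      children []      = refl
      children (i ∷ p) with hasChild? (Label.arity l) i
      ... | yes h = run-let (k i h) N p
      ... | no  _ = refl

  approx⊑run : ∀ {τ} n (M : Com Sig [] τ) → approx n M ⊑ ∣_∣ em M
  approx⊑run zero    M            = λ _ → inj₁ refl
  approx⊑run (suc n) (ƛ M · V)    =
    ⊑-trans (approx⊑run n (M [ V ])) (≈⇒⊑ run-app)
  approx⊑run (suc n) (return V)   = ≈⇒⊑ (≈-sym (run-⇓ ⇓return))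
  approx⊑run (suc n) (let-in M N) =
    ⊑-trans
      (bindT-mono (approx n M) (∣_∣ em M) (approx⊑run n M) (λ V → approx⊑run n (N [ V ])))
      (≈⇒⊑ (run-let M N))
  approx⊑run (suc n) (fix F)      = ≈⇒⊑ (≈-sym (run-⇓ ⇓fix))
  approx⊑run (suc n) (case Z M N) =
    ⊑-trans (approx⊑run n M) (≈⇒⊑ (run-case-Z {N = N}))
  approx⊑run (suc n) (case (S V) M N) =
    ⊑-trans (approx⊑run n (N [ V ])) (≈⇒⊑ (run-case-S {M = M} {N = N}))
  approx⊑run (suc n) (op-fin σ Ms) =
    ⊑-trans (nodeT-mono (λ i h → approx⊑run n (lookup Ms (fromℕ< h))))
      (≈⇒⊑ (≈-sym (run-⇓ ⇓op-fin)))
  approx⊑run (suc n) (op-nat×fin σ V Ms) =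
    ⊑-trans (nodeT-mono (λ i h → approx⊑run n (lookup Ms (fromℕ< h))))
      (≈⇒⊑ (≈-sym (run-⇓ ⇓op-nat×fin)))
  approx⊑run (suc n) (op-inf σ V) =
    ⊑-trans (nodeT-mono (λ i h → approx⊑run n (V · numeral i)))
      (≈⇒⊑ (≈-sym (run-⇓ ⇓op-inf)))
  approx⊑run (suc n) (op-nat×inf σ V W) =
    ⊑-trans (nodeT-mono (λ i h → approx⊑run n (W · numeral i)))
      (≈⇒⊑ (≈-sym (run-⇓ ⇓op-nat×inf)))

  -- Every position that carries a label is reached after finitely many evaluations. The fuel is
  -- found by induction on the position, adding the cost of the current outcome to that of the
  -- remaining path.
  run-attained : ∀ {τ} p (M : Com Sig [] τ) →
                 at (∣_∣ em M) p ≡ bot ⊎ ∃[ n ] at (approx n M) p ≡ at (∣_∣ em M) p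
  outcome-attained : ∀ {τ} p (o : Outcome τ) →
                     at (outcomeT (∣_∣ em) o) p ≡ bot ⊎
                     ∃[ m ] at (outcomeT (approx m) o) p ≡ at (outcomeT (∣_∣ em) o) p

  run-attained p M = by-outcome em
    where
    by-outcome : Dec (∃ (M ⇓_)) →
                 at (∣_∣ em M) p ≡ bot ⊎ ∃[ n ] at (approx n M) p ≡ at (∣_∣ em M) p
    by-outcome (no ¬d) = inj₁ (run-⇑ ¬d p)
    by-outcome (yes (o , d)) with outcome-attained p o | ⇓⇒approx d
    ... | inj₁ ≡⊥       | _         = inj₁ (trans (run-⇓ d p) ≡⊥)
    ... | inj₂ (m , eq) | n , bound with bound m p
    ...   | inj₁ ≡⊥ = inj₁ (trans (run-⇓ d p) (trans (sym eq) ≡⊥))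
    ...   | inj₂ ≡a = inj₂ (n + m , trans (sym ≡a) (trans eq (sym (run-⇓ d p))))

  -- Fuel affects only what lies below an effect, so `0` serves for a value and for the root of an
  -- effect.
  outcome-attained p       (value V)    = inj₂ (0 , refl)
  outcome-attained []      (effect l k) = inj₂ (0 , refl)
  outcome-attained (i ∷ p) (effect l k) with hasChild? (Label.arity l) i
  ... | yes h = run-attained p (k i h)
  ... | no  _ = inj₁ refl

  run-pointwiseSup : ∀ {τ} (M : Com Sig [] τ) →
                     IsPointwiseSup (λ n → approx n M) (∣_∣ em M)
  run-pointwiseSup M = (λ n → approx⊑run n M) , (λ p → run-attained p M)

-- Substitution

module _ {Sig : Signature} where

  case-cong : ∀ {Γ τ V V′} {M M′ : Com Sig Γ τ} {N N′} →
              V ≡ V′ → M ≡ M′ → N ≡ N′ → case V M N ≡ case V′ M′ N′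
  case-cong refl refl refl = refl

  -- In all fusion laws the composite is a third map, known only pointwise, so that the hypothesis
  -- can be lifted under binders without function extensionality. Their order is forced: lifting a
  -- composite of substitutions uses both mixed laws, and lifting a renaming after a substitution
  -- uses fusion of renamings.
  liftRen-liftRen : ∀ {Γ Δ Θ} {r : Ren {Sig} Δ Θ} {r′ : Ren {Sig} Γ Δ} {r″ : Ren {Sig} Γ Θ} →
    (∀ {τ} (x : τ ∈ Γ) → r (r′ x) ≡ r″ x) →
    ∀ {τ ρ} (x : τ ∈ ρ ∷ Γ) →
    liftRen {Sig} r (liftRen {Sig} r′ x) ≡ liftRen {Sig} r″ x
  liftRen-liftRen eqs (here eq) = refl
  liftRen-liftRen eqs (there x) = cong there (eqs x)

  renVal-ren : ∀ {Γ Δ Θ} {r : Ren {Sig} Δ Θ} {r′ : Ren {Sig} Γ Δ} {r″ : Ren {Sig} Γ Θ} →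
    (∀ {τ} (x : τ ∈ Γ) → r (r′ x) ≡ r″ x) →
    ∀ {τ} (V : Val Sig Γ τ) → renVal r (renVal r′ V) ≡ renVal r″ V
  renCom-ren : ∀ {Γ Δ Θ} {r : Ren {Sig} Δ Θ} {r′ : Ren {Sig} Γ Δ} {r″ : Ren {Sig} Γ Θ} →
    (∀ {τ} (x : τ ∈ Γ) → r (r′ x) ≡ r″ x) →
    ∀ {τ} (M : Com Sig Γ τ) → renCom r (renCom r′ M) ≡ renCom r″ M
  renComs-ren : ∀ {Γ Δ Θ} {r : Ren {Sig} Δ Θ} {r′ : Ren {Sig} Γ Δ} {r″ : Ren {Sig} Γ Θ} →
    (∀ {τ} (x : τ ∈ Γ) → r (r′ x) ≡ r″ x) →
    ∀ {τ n} (Ms : Vec (Com Sig Γ τ) n) → renComs r (renComs r′ Ms) ≡ renComs r″ Ms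

  renVal-ren eqs ⋆       = refl
  renVal-ren eqs Z       = refl
  renVal-ren eqs (S V)   = cong S (renVal-ren eqs V)
  renVal-ren eqs (ƛ M)   = cong ƛ (renCom-ren (liftRen-liftRen eqs) M)
  renVal-ren eqs (var x) = cong var (eqs x)

  renCom-ren eqs (V · W)             =
    cong₂ _·_ (renVal-ren eqs V) (renVal-ren eqs W)
  renCom-ren eqs (return V)          =
    cong return (renVal-ren eqs V)
  renCom-ren eqs (let-in M N)        =
    cong₂ let-in (renCom-ren eqs M) (renCom-ren (liftRen-liftRen eqs) N)
  renCom-ren eqs (fix V)             =
    cong fix (renVal-ren eqs V)
  renCom-ren eqs (case V M N)        =
    case-cong (renVal-ren eqs V) (renCom-ren eqs M) (renCom-ren (liftRen-liftRen eqs) N)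
  renCom-ren eqs (op-fin σ Ms)       =
    cong (op-fin σ) (renComs-ren eqs Ms)
  renCom-ren eqs (op-nat×fin σ V Ms) =
    cong₂ (op-nat×fin σ) (renVal-ren eqs V) (renComs-ren eqs Ms)
  renCom-ren eqs (op-inf σ V)        =
    cong (op-inf σ) (renVal-ren eqs V)
  renCom-ren eqs (op-nat×inf σ V W)  =
    cong₂ (op-nat×inf σ) (renVal-ren eqs V) (renVal-ren eqs W)

  renComs-ren eqs []       = refl
  renComs-ren eqs (M ∷ Ms) = cong₂ _∷_ (renCom-ren eqs M) (renComs-ren eqs Ms)

  liftSub-liftRen : ∀ {Γ Δ Θ} {s : Sub {Sig} Δ Θ} {r : Ren {Sig} Γ Δ} {s′ : Sub {Sig} Γ Θ} →
    (∀ {τ} (x : τ ∈ Γ) → s (r x) ≡ s′ x) →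
    ∀ {τ ρ} (x : τ ∈ ρ ∷ Γ) → liftSub s (liftRen {Sig} r x) ≡ liftSub s′ x
  liftSub-liftRen eqs (here eq) = refl
  liftSub-liftRen eqs (there x) = cong weaken (eqs x)

  subVal-ren : ∀ {Γ Δ Θ} {s : Sub {Sig} Δ Θ} {r : Ren {Sig} Γ Δ} {s′ : Sub {Sig} Γ Θ} →
    (∀ {τ} (x : τ ∈ Γ) → s (r x) ≡ s′ x) →
    ∀ {τ} (V : Val Sig Γ τ) → subVal s (renVal r V) ≡ subVal s′ V
  subCom-ren : ∀ {Γ Δ Θ} {s : Sub {Sig} Δ Θ} {r : Ren {Sig} Γ Δ} {s′ : Sub {Sig} Γ Θ} →
    (∀ {τ} (x : τ ∈ Γ) → s (r x) ≡ s′ x) →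
    ∀ {τ} (M : Com Sig Γ τ) → subCom s (renCom r M) ≡ subCom s′ M
  subComs-ren : ∀ {Γ Δ Θ} {s : Sub {Sig} Δ Θ} {r : Ren {Sig} Γ Δ} {s′ : Sub {Sig} Γ Θ} →
    (∀ {τ} (x : τ ∈ Γ) → s (r x) ≡ s′ x) →
    ∀ {τ n} (Ms : Vec (Com Sig Γ τ) n) → subComs s (renComs r Ms) ≡ subComs s′ Ms

  subVal-ren eqs ⋆       = refl
  subVal-ren eqs Z       = refl
  subVal-ren eqs (S V)   = cong S (subVal-ren eqs V)
  subVal-ren eqs (ƛ M)   = cong ƛ (subCom-ren (liftSub-liftRen eqs) M)
  subVal-ren eqs (var x) = eqs x

  subCom-ren eqs (V · W)             =
    cong₂ _·_ (subVal-ren eqs V) (subVal-ren eqs W)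
  subCom-ren eqs (return V)          =
    cong return (subVal-ren eqs V)
  subCom-ren eqs (let-in M N)        =
    cong₂ let-in (subCom-ren eqs M) (subCom-ren (liftSub-liftRen eqs) N)
  subCom-ren eqs (fix V)             =
    cong fix (subVal-ren eqs V)
  subCom-ren eqs (case V M N)        =
    case-cong (subVal-ren eqs V) (subCom-ren eqs M) (subCom-ren (liftSub-liftRen eqs) N)
  subCom-ren eqs (op-fin σ Ms)       =
    cong (op-fin σ) (subComs-ren eqs Ms)
  subCom-ren eqs (op-nat×fin σ V Ms) =
    cong₂ (op-nat×fin σ) (subVal-ren eqs V) (subComs-ren eqs Ms)
  subCom-ren eqs (op-inf σ V)        =
    cong (op-inf σ) (subVal-ren eqs V)
  subCom-ren eqs (op-nat×inf σ V W)  =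
    cong₂ (op-nat×inf σ) (subVal-ren eqs V) (subVal-ren eqs W)

  subComs-ren eqs []       = refl
  subComs-ren eqs (M ∷ Ms) = cong₂ _∷_ (subCom-ren eqs M) (subComs-ren eqs Ms)

  renVal-weaken : ∀ {Γ Δ ρ} (r : Ren {Sig} Γ Δ) {τ} (V : Val Sig Γ τ) →
    renVal (liftRen {Sig} {τ = ρ} r) (weaken V) ≡ weaken (renVal r V)
  renVal-weaken r V =
    trans (renVal-ren (λ x → refl) V) (sym (renVal-ren (λ x → refl) V))

  liftRen-liftSub : ∀ {Γ Δ Θ} {r : Ren {Sig} Δ Θ} {s : Sub {Sig} Γ Δ} {s′ : Sub {Sig} Γ Θ} →
    (∀ {τ} (x : τ ∈ Γ) → renVal r (s x) ≡ s′ x) →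
    ∀ {τ ρ} (x : τ ∈ ρ ∷ Γ) → renVal (liftRen {Sig} r) (liftSub s x) ≡ liftSub s′ x
  liftRen-liftSub eqs (here eq) = refl
  liftRen-liftSub {r = r} {s} eqs (there x) =
    trans (renVal-weaken r (s x)) (cong weaken (eqs x))

  renVal-sub : ∀ {Γ Δ Θ} {r : Ren {Sig} Δ Θ} {s : Sub {Sig} Γ Δ} {s′ : Sub {Sig} Γ Θ} →
    (∀ {τ} (x : τ ∈ Γ) → renVal r (s x) ≡ s′ x) →
    ∀ {τ} (V : Val Sig Γ τ) → renVal r (subVal s V) ≡ subVal s′ V
  renCom-sub : ∀ {Γ Δ Θ} {r : Ren {Sig} Δ Θ} {s : Sub {Sig} Γ Δ} {s′ : Sub {Sig} Γ Θ} →
    (∀ {τ} (x : τ ∈ Γ) → renVal r (s x) ≡ s′ x) →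
    ∀ {τ} (M : Com Sig Γ τ) → renCom r (subCom s M) ≡ subCom s′ M
  renComs-sub : ∀ {Γ Δ Θ} {r : Ren {Sig} Δ Θ} {s : Sub {Sig} Γ Δ} {s′ : Sub {Sig} Γ Θ} →
    (∀ {τ} (x : τ ∈ Γ) → renVal r (s x) ≡ s′ x) →
    ∀ {τ n} (Ms : Vec (Com Sig Γ τ) n) → renComs r (subComs s Ms) ≡ subComs s′ Ms

  renVal-sub eqs ⋆       = refl
  renVal-sub eqs Z       = refl
  renVal-sub eqs (S V)   = cong S (renVal-sub eqs V)
  renVal-sub eqs (ƛ M)   = cong ƛ (renCom-sub (liftRen-liftSub eqs) M)
  renVal-sub eqs (var x) = eqs x

  renCom-sub eqs (V · W)             =
    cong₂ _·_ (renVal-sub eqs V) (renVal-sub eqs W)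
  renCom-sub eqs (return V)          =
    cong return (renVal-sub eqs V)
  renCom-sub eqs (let-in M N)        =
    cong₂ let-in (renCom-sub eqs M) (renCom-sub (liftRen-liftSub eqs) N)
  renCom-sub eqs (fix V)             =
    cong fix (renVal-sub eqs V)
  renCom-sub eqs (case V M N)        =
    case-cong (renVal-sub eqs V) (renCom-sub eqs M) (renCom-sub (liftRen-liftSub eqs) N)
  renCom-sub eqs (op-fin σ Ms)       =
    cong (op-fin σ) (renComs-sub eqs Ms)
  renCom-sub eqs (op-nat×fin σ V Ms) =
    cong₂ (op-nat×fin σ) (renVal-sub eqs V) (renComs-sub eqs Ms)
  renCom-sub eqs (op-inf σ V)        =
    cong (op-inf σ) (renVal-sub eqs V)
  renCom-sub eqs (op-nat×inf σ V W)  =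
    cong₂ (op-nat×inf σ) (renVal-sub eqs V) (renVal-sub eqs W)

  renComs-sub eqs []       = refl
  renComs-sub eqs (M ∷ Ms) = cong₂ _∷_ (renCom-sub eqs M) (renComs-sub eqs Ms)

  subVal-weaken : ∀ {Γ Δ ρ} (s : Sub {Sig} Γ Δ) {τ} (V : Val Sig Γ τ) →
    subVal (liftSub {τ = ρ} s) (weaken V) ≡ weaken (subVal s V)
  subVal-weaken s V =
    trans (subVal-ren (λ x → refl) V) (sym (renVal-sub (λ x → refl) V))

  liftSub-liftSub : ∀ {Γ Δ Θ} {s : Sub {Sig} Δ Θ} {s′ : Sub {Sig} Γ Δ} {s″ : Sub {Sig} Γ Θ} →
    (∀ {τ} (x : τ ∈ Γ) → subVal s (s′ x) ≡ s″ x) →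
    ∀ {τ ρ} (x : τ ∈ ρ ∷ Γ) → subVal (liftSub s) (liftSub s′ x) ≡ liftSub s″ x
  liftSub-liftSub eqs (here eq) = refl
  liftSub-liftSub {s = s} {s′} eqs (there x) =
    trans (subVal-weaken s (s′ x)) (cong weaken (eqs x))

  subVal-sub : ∀ {Γ Δ Θ} {s : Sub {Sig} Δ Θ} {s′ : Sub {Sig} Γ Δ} {s″ : Sub {Sig} Γ Θ} →
    (∀ {τ} (x : τ ∈ Γ) → subVal s (s′ x) ≡ s″ x) →
    ∀ {τ} (V : Val Sig Γ τ) → subVal s (subVal s′ V) ≡ subVal s″ V
  subCom-sub : ∀ {Γ Δ Θ} {s : Sub {Sig} Δ Θ} {s′ : Sub {Sig} Γ Δ} {s″ : Sub {Sig} Γ Θ} →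
    (∀ {τ} (x : τ ∈ Γ) → subVal s (s′ x) ≡ s″ x) →
    ∀ {τ} (M : Com Sig Γ τ) → subCom s (subCom s′ M) ≡ subCom s″ M
  subComs-sub : ∀ {Γ Δ Θ} {s : Sub {Sig} Δ Θ} {s′ : Sub {Sig} Γ Δ} {s″ : Sub {Sig} Γ Θ} →
    (∀ {τ} (x : τ ∈ Γ) → subVal s (s′ x) ≡ s″ x) →
    ∀ {τ n} (Ms : Vec (Com Sig Γ τ) n) → subComs s (subComs s′ Ms) ≡ subComs s″ Ms

  subVal-sub eqs ⋆       = refl
  subVal-sub eqs Z       = refl
  subVal-sub eqs (S V)   = cong S (subVal-sub eqs V)
  subVal-sub eqs (ƛ M)   = cong ƛ (subCom-sub (liftSub-liftSub eqs) M)
  subVal-sub eqs (var x) = eqs x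

  subCom-sub eqs (V · W)             =
    cong₂ _·_ (subVal-sub eqs V) (subVal-sub eqs W)
  subCom-sub eqs (return V)          =
    cong return (subVal-sub eqs V)
  subCom-sub eqs (let-in M N)        =
    cong₂ let-in (subCom-sub eqs M) (subCom-sub (liftSub-liftSub eqs) N)
  subCom-sub eqs (fix V)             =
    cong fix (subVal-sub eqs V)
  subCom-sub eqs (case V M N)        =
    case-cong (subVal-sub eqs V) (subCom-sub eqs M) (subCom-sub (liftSub-liftSub eqs) N)
  subCom-sub eqs (op-fin σ Ms)       =
    cong (op-fin σ) (subComs-sub eqs Ms)
  subCom-sub eqs (op-nat×fin σ V Ms) =
    cong₂ (op-nat×fin σ) (subVal-sub eqs V) (subComs-sub eqs Ms)
  subCom-sub eqs (op-inf σ V)        =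
    cong (op-inf σ) (subVal-sub eqs V)
  subCom-sub eqs (op-nat×inf σ V W)  =
    cong₂ (op-nat×inf σ) (subVal-sub eqs V) (subVal-sub eqs W)

  subComs-sub eqs []       = refl
  subComs-sub eqs (M ∷ Ms) = cong₂ _∷_ (subCom-sub eqs M) (subComs-sub eqs Ms)

  liftSub-id : ∀ {Γ} {s : Sub {Sig} Γ Γ} → (∀ {τ} (x : τ ∈ Γ) → s x ≡ var x) →
    ∀ {τ ρ} (x : τ ∈ ρ ∷ Γ) → liftSub s x ≡ var x
  liftSub-id eqs (here eq) = refl
  liftSub-id eqs (there x) = cong weaken (eqs x)

  subVal-id : ∀ {Γ} {s : Sub {Sig} Γ Γ} →
    (∀ {τ} (x : τ ∈ Γ) → s x ≡ var x) →
    ∀ {τ} (V : Val Sig Γ τ) → subVal s V ≡ V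
  subCom-id : ∀ {Γ} {s : Sub {Sig} Γ Γ} →
    (∀ {τ} (x : τ ∈ Γ) → s x ≡ var x) →
    ∀ {τ} (M : Com Sig Γ τ) → subCom s M ≡ M
  subComs-id : ∀ {Γ} {s : Sub {Sig} Γ Γ} →
    (∀ {τ} (x : τ ∈ Γ) → s x ≡ var x) →
    ∀ {τ n} (Ms : Vec (Com Sig Γ τ) n) → subComs s Ms ≡ Ms

  subVal-id eqs ⋆       = refl
  subVal-id eqs Z       = refl
  subVal-id eqs (S V)   = cong S (subVal-id eqs V)
  subVal-id eqs (ƛ M)   = cong ƛ (subCom-id (liftSub-id eqs) M)
  subVal-id eqs (var x) = eqs x

  subCom-id eqs (V · W)             =
    cong₂ _·_ (subVal-id eqs V) (subVal-id eqs W)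
  subCom-id eqs (return V)          =
    cong return (subVal-id eqs V)
  subCom-id eqs (let-in M N)        =
    cong₂ let-in (subCom-id eqs M) (subCom-id (liftSub-id eqs) N)
  subCom-id eqs (fix V)             =
    cong fix (subVal-id eqs V)
  subCom-id eqs (case V M N)        =
    case-cong (subVal-id eqs V) (subCom-id eqs M) (subCom-id (liftSub-id eqs) N)
  subCom-id eqs (op-fin σ Ms)       =
    cong (op-fin σ) (subComs-id eqs Ms)
  subCom-id eqs (op-nat×fin σ V Ms) =
    cong₂ (op-nat×fin σ) (subVal-id eqs V) (subComs-id eqs Ms)
  subCom-id eqs (op-inf σ V)        =
    cong (op-inf σ) (subVal-id eqs V)
  subCom-id eqs (op-nat×inf σ V W)  =
    cong₂ (op-nat×inf σ) (subVal-id eqs V) (subVal-id eqs W)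

  subComs-id eqs []       = refl
  subComs-id eqs (M ∷ Ms) = cong₂ _∷_ (subCom-id eqs M) (subComs-id eqs Ms)

-- The Howe closure

record IsClosedPreorder {Sig : Signature} (R : ClosedRel Sig 0ℓ) : Set where
  field
    val-refl  : ∀ {τ} {V : Val Sig [] τ} → val R V V
    com-refl  : ∀ {τ} {M : Com Sig [] τ} → com R M M
    val-trans : ∀ {τ} {U V W : Val Sig [] τ} → val R U V → val R V W → val R U W
    com-trans : ∀ {τ} {L M N : Com Sig [] τ} → com R L M → com R M N → com R L N

module HoweClosure {Sig : Signature} (R : ClosedRel Sig 0ℓ)
         (R-preorder : IsClosedPreorder R) where

  open IsClosedPreorder R-preorder

  data HoweVal {Γ τ} (V W : Val Sig Γ τ) : Set
  data HoweCom {Γ τ} (M N : Com Sig Γ τ) : Set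

  -- Ref stands for the compatible refinement of the Howe closure.

  data RefVal {Γ} : ∀ {τ} → Val Sig Γ τ → Val Sig Γ τ → Set where
    r-var : ∀ {τ} (x : τ ∈ Γ) → RefVal (var x) (var x)
    r-⋆   : RefVal ⋆ ⋆
    r-Z   : RefVal Z Z
    r-S   : ∀ {V V′} → HoweVal V V′ → RefVal (S V) (S V′)
    r-ƛ   : ∀ {τ ρ} {M M′ : Com Sig (τ ∷ Γ) ρ} → HoweCom M M′ → RefVal (ƛ M) (ƛ M′)

  data RefCom {Γ} : ∀ {τ} → Com Sig Γ τ → Com Sig Γ τ → Set where
    r-app : ∀ {τ ρ} {V V′ : Val Sig Γ (τ ⇒ ρ)} {W W′} →
            HoweVal V V′ → HoweVal W W′ → RefCom (V · W) (V′ · W′)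
    r-return : ∀ {τ} {V V′ : Val Sig Γ τ} →
               HoweVal V V′ → RefCom (return V) (return V′)
    r-let : ∀ {τ ρ} {M M′ : Com Sig Γ τ} {N N′ : Com Sig (τ ∷ Γ) ρ} →
            HoweCom M M′ → HoweCom N N′ → RefCom (let-in M N) (let-in M′ N′)
    r-fix : ∀ {τ ρ} {V V′ : Val Sig Γ ((τ ⇒ ρ) ⇒ (τ ⇒ ρ))} →
            HoweVal V V′ → RefCom (fix V) (fix V′)
    r-case : ∀ {τ V V′} {M M′ : Com Sig Γ τ} {N N′} →
             HoweVal V V′ → HoweCom M M′ → HoweCom N N′ →
             RefCom (case V M N) (case V′ M′ N′)
    r-op-fin : ∀ {τ n} (σ : Sig (fin n)) {Ms Ms′ : Vec (Com Sig Γ τ) n} →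
               Pointwise HoweCom Ms Ms′ → RefCom (op-fin σ Ms) (op-fin σ Ms′)
    r-op-nat×fin : ∀ {τ n} (σ : Sig (nat×fin n)) {V V′} {Ms Ms′ : Vec (Com Sig Γ τ) n} →
                   HoweVal V V′ → Pointwise HoweCom Ms Ms′ →
                   RefCom (op-nat×fin σ V Ms) (op-nat×fin σ V′ Ms′)
    r-op-inf : ∀ {τ} (σ : Sig inf) {V V′ : Val Sig Γ (𝐍 ⇒ τ)} →
               HoweVal V V′ → RefCom (op-inf σ V) (op-inf σ V′)
    r-op-nat×inf : ∀ {τ} (σ : Sig nat×inf) {V V′} {W W′ : Val Sig Γ (𝐍 ⇒ τ)} →
                   HoweVal V V′ → HoweVal W W′ →
                   RefCom (op-nat×inf σ V W) (op-nat×inf σ V′ W′)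

  -- With `R` composed on the right only, a derivation can be inverted along the constructor of the
  -- left term, which is the term that `approx` evaluates.
  data HoweVal {Γ} V W where
    _⨾_ : ∀ {V′} → RefVal V V′ → val (OpenExtension R Γ) V′ W → HoweVal V W

  data HoweCom {Γ} M N where
    _⨾_ : ∀ {M′} → RefCom M M′ → com (OpenExtension R Γ) M′ N → HoweCom M N

  -- Needed before substitution: `liftSub` weakens the substituted values, and these must stay
  -- related under binders. The `R`-part survives because a closing substitution precomposed with a
  -- renaming is again one.
  howeVal-ren : ∀ {Γ Δ τ} (r : Ren {Sig} Γ Δ) {V W : Val Sig Γ τ} →
                HoweVal V W → HoweVal (renVal r V) (renVal r W)
  howeCom-ren : ∀ {Γ Δ τ} (r : Ren {Sig} Γ Δ) {M N : Com Sig Γ τ} →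
                HoweCom M N → HoweCom (renCom r M) (renCom r N)
  howeComs-ren : ∀ {Γ Δ τ n} (r : Ren {Sig} Γ Δ) {Ms Ns : Vec (Com Sig Γ τ) n} →
                 Pointwise HoweCom Ms Ns → Pointwise HoweCom (renComs r Ms) (renComs r Ns)
  refVal-ren : ∀ {Γ Δ τ} (r : Ren {Sig} Γ Δ) {V W : Val Sig Γ τ} →
               RefVal V W → RefVal (renVal r V) (renVal r W)
  refCom-ren : ∀ {Γ Δ τ} (r : Ren {Sig} Γ Δ) {M N : Com Sig Γ τ} →
               RefCom M N → RefCom (renCom r M) (renCom r N)

  howeVal-ren r {W = W} (_⨾_ {V′} v V′RW) = refVal-ren r v ⨾ λ s →
    subst₂ (val R) (sym (subVal-ren {s = s} {r} (λ x → refl) V′))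
      (sym (subVal-ren {s = s} {r} (λ x → refl) W))
      (V′RW (λ x → s (r x)))
  howeCom-ren r {N = N} (_⨾_ {M′} m M′RN) = refCom-ren r m ⨾ λ s →
    subst₂ (com R) (sym (subCom-ren {s = s} {r} (λ x → refl) M′))
      (sym (subCom-ren {s = s} {r} (λ x → refl) N))
      (M′RN (λ x → s (r x)))
  howeComs-ren r []       = []
  howeComs-ren r (m ∷ ms) = howeCom-ren r m ∷ howeComs-ren r ms

  refVal-ren r (r-var x) = r-var (r x)
  refVal-ren r r-⋆       = r-⋆
  refVal-ren r r-Z       = r-Z
  refVal-ren r (r-S v)   = r-S (howeVal-ren r v)
  refVal-ren r (r-ƛ m)   = r-ƛ (howeCom-ren (liftRen {Sig} r) m)

  refCom-ren r (r-app v w)           = r-app (howeVal-ren r v) (howeVal-ren r w)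
  refCom-ren r (r-return v)          = r-return (howeVal-ren r v)
  refCom-ren r (r-let m n)           = r-let (howeCom-ren r m) (howeCom-ren (liftRen {Sig} r) n)
  refCom-ren r (r-fix v)             = r-fix (howeVal-ren r v)
  refCom-ren r (r-case v m n)        =
    r-case (howeVal-ren r v) (howeCom-ren r m) (howeCom-ren (liftRen {Sig} r) n)
  refCom-ren r (r-op-fin σ ms)       = r-op-fin σ (howeComs-ren r ms)
  refCom-ren r (r-op-nat×fin σ v ms) = r-op-nat×fin σ (howeVal-ren r v) (howeComs-ren r ms)
  refCom-ren r (r-op-inf σ v)        = r-op-inf σ (howeVal-ren r v)
  refCom-ren r (r-op-nat×inf σ v w)  = r-op-nat×inf σ (howeVal-ren r v) (howeVal-ren r w)

  HoweSub : ∀ {Γ Δ} → Sub {Sig} Γ Δ → Sub {Sig} Γ Δ → Set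
  HoweSub {Γ} s s′ = ∀ {τ} (x : τ ∈ Γ) → HoweVal (s x) (s′ x)

  compatVal : ∀ {Γ τ} {V W : Val Sig Γ τ} → RefVal V W → HoweVal V W
  compatVal v = v ⨾ λ s → val-refl

  compatCom : ∀ {Γ τ} {M N : Com Sig Γ τ} → RefCom M N → HoweCom M N
  compatCom m = m ⨾ λ s → com-refl

  howeVal-refl  : ∀ {Γ τ} (V : Val Sig Γ τ) → HoweVal V V
  howeCom-refl  : ∀ {Γ τ} (M : Com Sig Γ τ) → HoweCom M M
  howeComs-refl : ∀ {Γ τ n} (Ms : Vec (Com Sig Γ τ) n) → Pointwise HoweCom Ms Ms
  refVal-refl   : ∀ {Γ τ} (V : Val Sig Γ τ) → RefVal V V
  refCom-refl   : ∀ {Γ τ} (M : Com Sig Γ τ) → RefCom M M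

  howeVal-refl V = compatVal (refVal-refl V)
  howeCom-refl M = compatCom (refCom-refl M)
  howeComs-refl []       = []
  howeComs-refl (M ∷ Ms) = howeCom-refl M ∷ howeComs-refl Ms

  refVal-refl ⋆       = r-⋆
  refVal-refl Z       = r-Z
  refVal-refl (S V)   = r-S (howeVal-refl V)
  refVal-refl (ƛ M)   = r-ƛ (howeCom-refl M)
  refVal-refl (var x) = r-var x

  refCom-refl (V · W)             = r-app (howeVal-refl V) (howeVal-refl W)
  refCom-refl (return V)          = r-return (howeVal-refl V)
  refCom-refl (let-in M N)        = r-let (howeCom-refl M) (howeCom-refl N)
  refCom-refl (fix V)             = r-fix (howeVal-refl V)
  refCom-refl (case V M N)        = r-case (howeVal-refl V) (howeCom-refl M) (howeCom-refl N)
  refCom-refl (op-fin σ Ms)       = r-op-fin σ (howeComs-refl Ms)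
  refCom-refl (op-nat×fin σ V Ms) = r-op-nat×fin σ (howeVal-refl V) (howeComs-refl Ms)
  refCom-refl (op-inf σ V)        = r-op-inf σ (howeVal-refl V)
  refCom-refl (op-nat×inf σ V W)  = r-op-nat×inf σ (howeVal-refl V) (howeVal-refl W)

  liftSub-howe : ∀ {Γ Δ ρ} {s s′ : Sub {Sig} Γ Δ} → HoweSub s s′ →
                 HoweSub (liftSub {τ = ρ} s) (liftSub s′)
  liftSub-howe hs (here eq) = compatVal (r-var (here eq))
  liftSub-howe hs (there x) = howeVal-ren there (hs x)

  single-howe : ∀ {Γ τ} {V W : Val Sig Γ τ} → HoweVal V W →
                HoweSub (single V) (single W)
  single-howe v (here refl) = v
  single-howe v (there x)   = compatVal (r-var x)

  howeVal-trans : ∀ {Γ τ} {U V W : Val Sig Γ τ} →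
                  HoweVal U V → val (OpenExtension R Γ) V W → HoweVal U W
  howeVal-trans (u ⨾ URV) VRW = u ⨾ λ s → val-trans (URV s) (VRW s)

  -- The gain over the open extension of similarity, which by definition allows only one common
  -- substitution: here the two sides receive different, related values.
  howeVal-sub : ∀ {Γ Δ τ} {s s′ : Sub {Sig} Γ Δ} → HoweSub s s′ →
                {V W : Val Sig Γ τ} → HoweVal V W → HoweVal (subVal s V) (subVal s′ W)
  howeCom-sub : ∀ {Γ Δ τ} {s s′ : Sub {Sig} Γ Δ} → HoweSub s s′ →
                {M N : Com Sig Γ τ} → HoweCom M N → HoweCom (subCom s M) (subCom s′ N)
  howeComs-sub : ∀ {Γ Δ τ n} {s s′ : Sub {Sig} Γ Δ} → HoweSub s s′ →
                 {Ms Ns : Vec (Com Sig Γ τ) n} → Pointwise HoweCom Ms Ns →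
                 Pointwise HoweCom (subComs s Ms) (subComs s′ Ns)
  -- A variable turns into an arbitrary related pair, so the result lies only in the closure and the
  -- trailing `R`-step is absorbed by `howeVal-trans`. No computation is a variable, so `refCom-sub`
  -- stays in the refinement.
  refVal-sub : ∀ {Γ Δ τ} {s s′ : Sub {Sig} Γ Δ} → HoweSub s s′ →
               {V W : Val Sig Γ τ} → RefVal V W → HoweVal (subVal s V) (subVal s′ W)
  refCom-sub : ∀ {Γ Δ τ} {s s′ : Sub {Sig} Γ Δ} → HoweSub s s′ →
               {M N : Com Sig Γ τ} → RefCom M N → RefCom (subCom s M) (subCom s′ N)

  howeVal-sub {s′ = s′} hs {W = W} (_⨾_ {V′} v V′RW) =
    howeVal-trans (refVal-sub hs v) λ s →
      subst₂ (val R) (sym (subVal-sub {s = s} {s′} (λ x → refl) V′))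
        (sym (subVal-sub {s = s} {s′} (λ x → refl) W))
        (V′RW (λ x → subVal s (s′ x)))
  howeCom-sub {s′ = s′} hs {N = N} (_⨾_ {M′} m M′RN) = refCom-sub hs m ⨾ λ s →
    subst₂ (com R) (sym (subCom-sub {s = s} {s′} (λ x → refl) M′))
      (sym (subCom-sub {s = s} {s′} (λ x → refl) N))
      (M′RN (λ x → subVal s (s′ x)))
  howeComs-sub hs []       = []
  howeComs-sub hs (m ∷ ms) = howeCom-sub hs m ∷ howeComs-sub hs ms

  refVal-sub hs (r-var x) = hs x
  refVal-sub hs r-⋆       = compatVal r-⋆
  refVal-sub hs r-Z       = compatVal r-Z
  refVal-sub hs (r-S v)   = compatVal (r-S (howeVal-sub hs v))
  refVal-sub hs (r-ƛ m)   = compatVal (r-ƛ (howeCom-sub (liftSub-howe hs) m))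

  refCom-sub hs (r-app v w)           = r-app (howeVal-sub hs v) (howeVal-sub hs w)
  refCom-sub hs (r-return v)          = r-return (howeVal-sub hs v)
  refCom-sub hs (r-let m n)           =
    r-let (howeCom-sub hs m) (howeCom-sub (liftSub-howe hs) n)
  refCom-sub hs (r-fix v)             = r-fix (howeVal-sub hs v)
  refCom-sub hs (r-case v m n)        =
    r-case (howeVal-sub hs v) (howeCom-sub hs m) (howeCom-sub (liftSub-howe hs) n)
  refCom-sub hs (r-op-fin σ ms)       = r-op-fin σ (howeComs-sub hs ms)
  refCom-sub hs (r-op-nat×fin σ v ms) =
    r-op-nat×fin σ (howeVal-sub hs v) (howeComs-sub hs ms)
  refCom-sub hs (r-op-inf σ v)        = r-op-inf σ (howeVal-sub hs v)
  refCom-sub hs (r-op-nat×inf σ v w)  =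
    r-op-nat×inf σ (howeVal-sub hs v) (howeVal-sub hs w)

  howeCom-[] : ∀ {Γ τ ρ} {M N : Com Sig (τ ∷ Γ) ρ} {V W : Val Sig Γ τ} →
               HoweCom M N → HoweVal V W → HoweCom (M [ V ]) (N [ W ])
  howeCom-[] m v = howeCom-sub (single-howe v) m

  -- The recursive `fix` sits unevaluated under binders in the unrolling, so compatibility is enough
  -- and no induction over unfoldings arises.
  unroll-howe : ∀ {Γ τ ρ} {F G : Val Sig Γ ((τ ⇒ ρ) ⇒ (τ ⇒ ρ))} →
                HoweVal F G → HoweVal (unroll F) (unroll G)
  unroll-howe f =
    compatVal (r-ƛ (compatCom (r-let
      (compatCom (r-app (howeVal-ren there f)
        (compatVal (r-ƛ (compatCom (r-let
          (compatCom (r-fix (howeVal-ren there (howeVal-ren there f))))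
          (howeCom-refl _)))))))
      (howeCom-refl _))))

  -- Reduces the clauses of compatibility to inclusions: subterms are sent into the closure, and the
  -- rebuilt terms come back from the refinement. The level of `Q` is free because similarity lies
  -- above the level of `R`.
  compatible : ∀ {ℓ} {Q : OpenRel Sig ℓ} →
    (∀ {Γ τ} {V W : Val Sig Γ τ} → val (Q Γ) V W → HoweVal V W) →
    (∀ {Γ τ} {M N : Com Sig Γ τ} → com (Q Γ) M N → HoweCom M N) →
    (∀ {Γ τ} {V W : Val Sig Γ τ} → RefVal V W → val (Q Γ) V W) →
    (∀ {Γ τ} {M N : Com Sig Γ τ} → RefCom M N → com (Q Γ) M N) →
    Compatible Q
  compatible val⇒ com⇒ ⇒val ⇒com = record
    { c-var        = λ x → ⇒val (r-var x)
    ; c-⋆          = ⇒val r-⋆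
    ; c-Z          = ⇒val r-Z
    ; c-S          = λ v → ⇒val (r-S (val⇒ v))
    ; c-ƛ          = λ m → ⇒val (r-ƛ (com⇒ m))
    ; c-app        = λ v w → ⇒com (r-app (val⇒ v) (val⇒ w))
    ; c-return     = λ v → ⇒com (r-return (val⇒ v))
    ; c-let        = λ m n → ⇒com (r-let (com⇒ m) (com⇒ n))
    ; c-fix        = λ v → ⇒com (r-fix (val⇒ v))
    ; c-case       = λ v m n → ⇒com (r-case (val⇒ v) (com⇒ m) (com⇒ n))
    ; c-op-fin     = λ σ ms → ⇒com (r-op-fin σ (Pointwise.map com⇒ ms))
    ; c-op-nat×fin = λ σ v ms →
        ⇒com (r-op-nat×fin σ (val⇒ v) (Pointwise.map com⇒ ms))
    ; c-op-inf     = λ σ v → ⇒com (r-op-inf σ (val⇒ v))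
    ; c-op-nat×inf = λ σ v w → ⇒com (r-op-nat×inf σ (val⇒ v) (val⇒ w))
    }

-- The Howe closure of a simulation preorder

module HoweSimulation
         (em : ExcludedMiddle 0ℓ) {Sig : Signature} (𝒪 : Modalities Sig)
         (scott : AllScottOpen 𝒪) (decomposable : Decomposable em 𝒪)
         {R : ClosedRel Sig 0ℓ} (R-preorder : IsClosedPreorder R)
         (R-simulation : IsSimulation em 𝒪 R) where

  open RelatorLaws em 𝒪 scott decomposable
  open OperationalTrees em
  open HoweClosure R R-preorder
  open IsSimulation R-simulation

  -- Even over the empty context the open extension quantifies over substitutions; these act as the
  -- identity.
  closed-val : ∀ {τ} {V W : Val Sig [] τ} → val (OpenExtension R []) V W → val R V W
  closed-val VRW = subst₂ (val R) (subVal-id (λ ()) _) (subVal-id (λ ()) _) (VRW (λ ()))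

  closed-com : ∀ {τ} {M N : Com Sig [] τ} → com (OpenExtension R []) M N → com R M N
  closed-com MRN = subst₂ (com R) (subCom-id (λ ()) _) (subCom-id (λ ()) _) (MRN (λ ()))

  open-val : ∀ {τ} {V W : Val Sig [] τ} → val R V W → val (OpenExtension R []) V W
  open-val VRW s = subst₂ (val R) (sym (subVal-id (λ ()) _)) (sym (subVal-id (λ ()) _)) VRW

  howe-𝐍 : {V W : Val Sig [] 𝐍} → HoweVal V W → V ≡ W
  howe-𝐍 (r-Z ⨾ VRW)   = sim-𝐍 (closed-val VRW)
  howe-𝐍 (r-S v ⨾ VRW) = trans (cong S (howe-𝐍 v)) (sim-𝐍 (closed-val VRW))

  -- The counterpart of `howeVal-trans` on trees: a trailing `R`-step between computations becomes
  -- one between their leaves and is absorbed there.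
  related-howe : ∀ {τ t} M N → Related (HoweVal {τ = τ}) t (∣_∣ em M) → com R M N →
                 Related HoweVal t (∣_∣ em N)
  related-howe M N tHM MRN =
    related-mono (λ (_ , VHU , URW) → howeVal-trans VHU (open-val URW))
      (related-trans tHM (related {t = ∣_∣ em M} {∣_∣ em N} (sim-com MRN)))

  app-numeral : ∀ {Γ τ} {V W : Val Sig Γ (𝐍 ⇒ τ)} → HoweVal V W →
                ∀ i → HoweCom (V · numeral i) (W · numeral i)
  app-numeral v i = compatCom (r-app v (howeVal-refl (numeral i)))

  -- Substitution can enlarge derivations, so fuel carries the induction: `howe-approx` strips the
  -- `R`-step at equal fuel, and `ref-approx` spends one unit.
  howe-approx : ∀ n {τ} {M N : Com Sig [] τ} → HoweCom M N →
                Related HoweVal (approx n M) (∣_∣ em N)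
  ref-approx : ∀ n {τ} {M N : Com Sig [] τ} → RefCom M N →
               Related HoweVal (approx n M) (∣_∣ em N)

  howe-approx n (_⨾_ {M′} m M′RN) =
    related-howe M′ _ (ref-approx n m) (closed-com M′RN)

  ref-approx zero m = related-botT
  -- A closed function value is an abstraction, so its derivation is a pair of related bodies
  -- followed by `ƛ M′` being below `V′`. The bodies are instantiated with the related arguments;
  -- `sim-⇒` then replaces `ƛ M′` by `V′`.
  ref-approx (suc n) (r-app {V′ = V′} {W′ = W′} (r-ƛ {M′ = M′} m ⨾ λM′RV′) w) =
    related-howe (ƛ M′ · W′) (V′ · W′)
      (related-⊑ ⊑-refl (howe-approx n (howeCom-[] m w)) (≈⇒⊑ run-app))
      (sim-⇒ (closed-val λM′RV′) W′)
  ref-approx (suc n) (r-return v) =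
    related-⊑ ⊑-refl (related-leafT v) (≈⇒⊑ (≈-sym (run-⇓ ⇓return)))
  ref-approx (suc n) (r-let {M′ = M′} {N′ = N′} m k) =
    related-⊑ ⊑-refl
      (related-bindT _ _ (∣_∣ em M′) (λ V → ∣_∣ em (N′ [ V ]))
        (howe-approx n m)
        -- The two returned values are merely related, so both the bodies and the substituted values
        -- differ.
        (λ v → howe-approx n (howeCom-[] k v)))
      (≈⇒⊑ (run-let M′ N′))
  ref-approx (suc n) (r-fix v) =
    related-⊑ ⊑-refl (related-leafT (unroll-howe v)) (≈⇒⊑ (≈-sym (run-⇓ ⇓fix)))
  -- Related closed numbers are equal, hence both sides take the same branch with the same
  -- predecessor.
  ref-approx (suc n) (r-case {V = V} v m k) with howe-𝐍 v
  ref-approx (suc n) (r-case {V = Z} {N′ = N′} v m k) | refl =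
    related-⊑ ⊑-refl (howe-approx n m) (≈⇒⊑ (run-case-Z {N = N′}))
  ref-approx (suc n) (r-case {V = S V} {M′ = M′} {N′ = N′} v m k) | refl =
    related-⊑ ⊑-refl
      (howe-approx n (howeCom-[] k (howeVal-refl V)))
      (≈⇒⊑ (run-case-S {M = M′} {N = N′}))
  ref-approx (suc n) (r-op-fin σ ms) =
    related-⊑ ⊑-refl
      (related-nodeT _ _ (λ i h → howe-approx n (Pointwise.lookup ms (fromℕ< h))))
      (≈⇒⊑ (≈-sym (run-⇓ ⇓op-fin)))
  ref-approx (suc n) (r-op-nat×fin σ v ms) with howe-𝐍 v
  ... | refl =
    related-⊑ ⊑-refl
      (related-nodeT _ _ (λ i h → howe-approx n (Pointwise.lookup ms (fromℕ< h))))
      (≈⇒⊑ (≈-sym (run-⇓ ⇓op-nat×fin)))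
  ref-approx (suc n) (r-op-inf σ v) =
    related-⊑ ⊑-refl
      (related-nodeT _ _ (λ i h → howe-approx n (app-numeral v i)))
      (≈⇒⊑ (≈-sym (run-⇓ ⇓op-inf)))
  ref-approx (suc n) (r-op-nat×inf σ v w) with howe-𝐍 v
  ... | refl =
    related-⊑ ⊑-refl
      (related-nodeT _ _ (λ i h → howe-approx n (app-numeral w i)))
      (≈⇒⊑ (≈-sym (run-⇓ ⇓op-nat×inf)))

  howe : ClosedRel Sig 0ℓ
  howe .val = HoweVal
  howe .com = HoweCom

  howe-isSimulation : IsSimulation em 𝒪 howe
  howe-isSimulation .IsSimulation.sim-𝐍 = howe-𝐍
  howe-isSimulation .IsSimulation.sim-com {M = M} {N} m =
    relator (related-sup {t = ∣_∣ em M} {∣_∣ em N}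
      (approx-ascending M) (run-pointwiseSup M) (λ n → howe-approx n m))
  howe-isSimulation .IsSimulation.sim-⇒ v P = compatCom (r-app v (howeVal-refl P))

-- Similarity as a simulation preorder, and its compatibility

module _ (em : ∀ {ℓ} → ExcludedMiddle ℓ) {Sig : Signature} (𝒪 : Modalities Sig)
         (scott : AllScottOpen 𝒪) (decomposable : Decomposable em 𝒪) where

  open RelatorLaws em 𝒪 scott decomposable

  -- Excluded middle brings similarity down to the level of the simulations
  -- over which it is a union.

  similarity : ClosedRel Sig 0ℓ
  similarity .val V W = True (em {P = val (Similarity em 𝒪) V W})
  similarity .com M N = True (em {P = com (Similarity em 𝒪) M N})

  -- Each related pair comes with a simulation inside similarity; monotonicity of the relator
  -- enlarges that simulation to similarity.
  similarity-isSimulation : IsSimulation em 𝒪 similarity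
  similarity-isSimulation .IsSimulation.sim-𝐍 VsW =
    let (R , simulation , VRW) = toWitness VsW in IsSimulation.sim-𝐍 simulation VRW
  similarity-isSimulation .IsSimulation.sim-com {M = M} {N} MsN =
    let (R , simulation , MRN) = toWitness MsN in
    relator (related-mono {R = val R} {t = ∣_∣ em M} {∣_∣ em N}
      (λ VRW → fromWitness (R , simulation , VRW))
      (related (IsSimulation.sim-com simulation MRN)))
  similarity-isSimulation .IsSimulation.sim-⇒ VsW P =
    let (R , simulation , VRW) = toWitness VsW in
    fromWitness (R , simulation , IsSimulation.sim-⇒ simulation VRW P)

  ≡-isSimulation : IsSimulation em 𝒪 (record { val = _≡_ ; com = _≡_ })
  ≡-isSimulation .IsSimulation.sim-𝐍 V≡W = V≡W
  ≡-isSimulation .IsSimulation.sim-com {M = M} refl =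
    relator (related-refl {t = ∣_∣ em M} refl)
  ≡-isSimulation .IsSimulation.sim-⇒ V≡W P = cong (_· P) V≡W

  similarity² : ClosedRel Sig 0ℓ
  similarity² .val = val similarity ; val similarity
  similarity² .com = com similarity ; com similarity

  -- This yields transitivity, as the composite of similarity with itself is then part of the union.
  -- The computation clause holds because the relator is closed under composition.
  similarity²-isSimulation : IsSimulation em 𝒪 similarity²
  similarity²-isSimulation .IsSimulation.sim-𝐍 (_ , UsV , VsW) = trans (sim-𝐍 UsV) (sim-𝐍 VsW)
    where open IsSimulation similarity-isSimulation
  similarity²-isSimulation .IsSimulation.sim-com {M = L} {N} (M , LsM , MsN) =
    relator (related-trans {t = ∣_∣ em L} {∣_∣ em M} {∣_∣ em N}
      (related (sim-com LsM)) (related (sim-com MsN)))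
    where open IsSimulation similarity-isSimulation
  similarity²-isSimulation .IsSimulation.sim-⇒ (_ , UsV , VsW) P =
    _ , sim-⇒ UsV P , sim-⇒ VsW P
    where open IsSimulation similarity-isSimulation

  similarity-isPreorder : IsClosedPreorder similarity
  similarity-isPreorder = record
    { val-refl  = fromWitness (_ , ≡-isSimulation , refl)
    ; com-refl  = fromWitness (_ , ≡-isSimulation , refl)
    ; val-trans = λ UsV VsW → fromWitness (_ , similarity²-isSimulation , _ , UsV , VsW)
    ; com-trans = λ LsM MsN → fromWitness (_ , similarity²-isSimulation , _ , LsM , MsN)
    }

  open HoweClosure similarity similarity-isPreorder
  open HoweSimulation em 𝒪 scott decomposable
         similarity-isPreorder similarity-isSimulation using (howe; howe-isSimulation)

  similarity-compatible : Compatible (OpenExtension (Similarity em 𝒪))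
  similarity-compatible = compatible
    (λ {_} {_} {V} VsW → refVal-refl V ⨾ λ s → fromWitness (VsW s))
    (λ {_} {_} {M} MsN → refCom-refl M ⨾ λ s → fromWitness (MsN s))
    -- Closing with the same substitution on both sides keeps the terms in the closure, and `howe`
    -- is itself the simulation that witnesses similarity.
    (λ v s → howe , howe-isSimulation ,
      howeVal-sub (λ x → howeVal-refl (s x)) (compatVal v))
    (λ m s → howe , howe-isSimulation ,
      howeCom-sub (λ x → howeVal-refl (s x)) (compatCom m))

theorem3 : (em : ∀ {ℓ} → ExcludedMiddle ℓ) →
    (Sig : Signature) (𝒪 : Modalities Sig) →
    AllScottOpen 𝒪 → Decomposable em 𝒪 →
    Compatible (OpenExtension (Similarity em 𝒪))
theorem3 em Sig 𝒪 = similarity-compatible em 𝒪
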